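{- Let $s$ be a Sturmian word over $\{0,1\}$ and let $T:\{0,1\}^*\to\{0,1\}^*$ be a marked morphism. Then there exist constants $N$ and $k$ such that the permutation complexity of $T(s)$ satisfies $f_{T(s)}(n)=n+k$ for all $n>N$.
   Context: A Sturmian word is an infinite word having exactly $n+1$ distinct factors of length $n$ for every $n\ge 0$. A binary morphism $T$ is marked if $T(0)$ and $T(1)$ begin with different letters and end with different letters. Infinite words are compared in the lexicographic order induced by $0<1$. For an infinite aperiodic binary word $\omega=\omega_0\omega_1\cdots$, let $\pi_\omega$ be the linear order on $\mathbb{N}$ with $\pi_\omega(i)<\pi_\omega(j)$ iff $\omega[i,\infty]<\omega[j,\infty]$ lexicographically, where $\omega[i,\infty]=\omega_i\omega_{i+1}\cdots$. For $i<j$, $\pi_\omega[i,j]$ is the permutation of $\{1,\dots,j-i+1\}$ with $\pi_\omega[i,j](k)<\pi_\omega[i,j](m)$ iff $\pi_\omega(i+k-1)<\pi_\omega(i+m-1)$; these are the subpermutations of length $j-i+1$. The permutation complexity $f_\omega(n)$ is the number of distinct subpermutations of length $n$ of $\pi_\omega$. -}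

module Defs where

open import Data.Bool using (Bool; true; false)
open import Data.Nat using (ℕ; zero; suc; _+_; _<_)
open import Data.Integer using (ℤ; +_) renaming (_+_ to _+ℤ_)
open import Data.Fin using (Fin; toℕ) renaming (_<_ to _<ᶠ_)
open import Data.Vec using (Vec; lookup)
open import Data.List using (List; []; _∷_; _++_; length)
open import Data.List.NonEmpty using (List⁺; head; last; toList)
open import Data.List.Membership.Propositional using (_∈_)
open import Data.List.Relation.Unary.Unique.Propositional using (Unique)
open import Data.Product using (Σ; ∃; _×_; _,_)
open import Function using (_⇔_)
open import Function.Definitions using (Injective)
open import Relation.Binary.PropositionalEquality using (_≡_; _≢_)

-- Infinite binary words: ω : ℕ → Bool, with letter 0 = false, 1 = true
-- (so the lexicographic order induced by 0 < 1 is induced by false < true).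
Word : Set
Word = ℕ → Bool

HasCard : {A : Set} → (A → Set) → ℕ → Set
HasCard {A} P c = Σ (List A) λ xs → Unique xs × length xs ≡ c × (∀ x → P x ⇔ (x ∈ xs))

Factor : Word → (n : ℕ) → Vec Bool n → Set
Factor ω n w = ∃ λ i → ∀ (k : Fin n) → lookup w k ≡ ω (i + toℕ k)

Sturmian : Word → Set
Sturmian s = ∀ n → HasCard (Factor s n) (suc n)

-- A binary morphism is given by its images T(0), T(1).
-- Marked: T(0), T(1) begin with different letters and end with different letters
-- (in particular both images are nonempty).
Marked : List⁺ Bool → List⁺ Bool → Set
Marked a b = (head a ≢ head b) × (last a ≢ last b)

img : List⁺ Bool → List⁺ Bool → Bool → List⁺ Bool
img a b false = a
img a b true  = b

prefixImage : List⁺ Bool → List⁺ Bool → Word → ℕ → List Bool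
prefixImage a b s zero    = []
prefixImage a b s (suc m) = prefixImage a b s m ++ toList (img a b (s m))

-- i-th letter of a list, with a default (never used below, since images are nonempty)
nth : List Bool → ℕ → Bool
nth []       _       = false
nth (x ∷ xs) zero    = x
nth (x ∷ xs) (suc i) = nth xs i

-- T(s) as an infinite word: since |T(c)| ≥ 1, letter i of T(s) lies in
-- T(s_0)…T(s_i), which has length ≥ i+1.
applyMorph : List⁺ Bool → List⁺ Bool → Word → Word
applyMorph a b s i = nth (prefixImage a b s (suc i)) i

SufLt : Word → ℕ → ℕ → Set
SufLt ω i j = ∃ λ m → (∀ l → l < m → ω (i + l) ≡ ω (j + l)) × (ω (i + m) ≡ false) × (ω (j + m) ≡ true)

-- σ (a permutation of {1..n}, encoded as a permutation of Fin n stored as a vector)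
-- is the subpermutation π_ω[i, i+n-1] of length n starting at position i:
-- σ(k) < σ(m) iff π_ω(i+k) < π_ω(i+m) iff ω[i+k,∞] < ω[i+m,∞].
Subperm : Word → (n : ℕ) → Vec (Fin n) n → Set
Subperm ω n σ =
  Injective _≡_ _≡_ (lookup σ) ×
  ∃ λ i → ∀ (k m : Fin n) → (lookup σ k <ᶠ lookup σ m) ⇔ SufLt ω (i + toℕ k) (i + toℕ m)

PermComplexityIs : Word → ℕ → ℤ → Set
PermComplexityIs ω n v = Σ ℕ λ c → HasCard (Subperm ω n) c × (+ c ≡ v)

{-# OPTIONS --safe #-}
module Submission where

-- Let ω = T(s).  Balance of s bounds the powers of each word occurring in s, hence in ω.  Two
-- parsings of a long factor of ω into blocks T(0), T(1) without a common cut would determine each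
-- other, letter by letter, and so produce such a power; as T is marked, a common cut propagates
-- both ways.  Hence a factor of some length L fixes the block structure around it, long right
-- special factors of ω are images of right special factors of s, and there is exactly one of each
-- length: ω has M + const factors of length M.
--
-- Suffixes of ω agreeing on L letters are compared like the corresponding suffixes of s, and
-- balance shows that the order of the suffixes of s starting in a window is determined by the
-- window.  Only comparisons decided within L letters can look beyond the window; as ω is uniformly
-- recurrent and the right special factor has only one continuation after each branch, how far they
-- look does not depend on the window.  So for large n there is a constant c such that the
-- subpermutations of length n + 1 correspond to the factors of length n + c.

open import Defs
open import Data.Bool using (Bool; true; false; not)
import Data.Bool.Properties as Bool
open import Data.Empty using (⊥; ⊥-elim)
open import Data.Fin using (Fin; toℕ; fromℕ<; combine; punchOut) renaming (zero to fzero; suc to fsuc; _<_ to _<ᶠ_)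
import Data.Fin.Properties as Fin
open import Data.Integer using (ℤ)
import Data.Integer as ℤ
import Data.Integer.Properties as ℤ
open import Data.List using (List; []; _∷_; _++_; length)
import Data.List as List
open import Data.List.Membership.Propositional using (_∈_)
open import Data.List.Membership.Propositional.Properties using (∈-lookup; ∈-tabulate⁺; ∈-tabulate⁻)
open import Data.List.NonEmpty as List⁺ using (List⁺; head; tail; last; toList)
open import Data.List.Properties using (length-tabulate; length-++)
import Data.List.Relation.Unary.All as All
open import Data.List.Relation.Unary.AllPairs using (_∷_)
open import Data.List.Relation.Unary.Any using (index)
open import Data.List.Relation.Unary.Any.Properties using (lookup-index)
open import Data.List.Relation.Unary.Unique.Propositional using (Unique)
open import Data.List.Relation.Unary.Unique.Propositional.Properties using (tabulate⁺)
open import Data.Nat hiding (_/_; _%_)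
open import Data.Nat.DivMod using (_/_; _%_; m≡m%n+[m/n]*n; m%n<n)
open import Data.Nat.Properties
open import Data.Nat.Tactic.RingSolver using (solve)
open import Data.Product
open import Data.Sum using (_⊎_; inj₁; inj₂)
open import Data.Vec using (Vec; lookup; tabulate)
import Data.Vec.Properties as Vec
open import Function using (_∘_; _⇔_; case_of_; Equivalence; mk⇔)
open import Function.Definitions using (Injective)
open import Relation.Binary.Definitions using (tri<; tri≈; tri>)
open import Relation.Binary.PropositionalEquality
open import Relation.Nullary
open import Relation.Nullary.Decidable using (dec-true; dec-false)

-- In lin h e the hypotheses, summed up in h by _⊕_, are subtracted from the goal; what remains
-- to be checked is the semiring identity e.

-- Let the suffixes at p and q share exactly M letters and continue with 0 and 1. Compare offsets k
-- < m with m + r = M. Passing from p to q raises the suffix at m at depth r, whereas the suffix at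
-- k changes only deeper. So `p + k` below `p + m` stays below; only the opposite order can be
-- reversed. Past depth L a reversal would be one between suffixes of s, which balance excludes.
-- Within depth L it needs a suffix strictly between the two versions of the suffix starting r
-- letters before the fork, and near a fork everything looks as at one fixed reference fork. The
-- constant `c` is one more than the largest r < L at which such a suffix exists, or 0. For smaller
-- r nothing needs to be known: a fork at M with n ≤ M < n + c is always detected at the offset M -
-- (c - 1), which still lies in the window.
--
-- The proof is constructive: bounds on runs and on recurrence times are explicit numbers, so that
-- mismatches, suffixes in between and classes of factors are found by bounded search.

infixr 6 _⊕_
_⊕_ : ∀ {a b c d} → a ≤ b → c ≤ d → a + c ≤ b + d
_⊕_ = +-mono-≤

lin : ∀ {a b x y} → a ≤ b → x + b ≡ y + a → x ≤ y
lin {a} {b} {x} {y} h e = +-cancelʳ-≤ a x y (≤-trans (+-monoʳ-≤ x h) (≤-reflexive e))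

lin≡ : ∀ {a b x y} → a ≡ b → x + b ≡ y + a → x ≡ y
lin≡ {a} {x = x} {y} refl e = +-cancelʳ-≡ a x y e

+-swapʳ : ∀ a b c → a + b + c ≡ a + c + b
+-swapʳ a b c = solve (a ∷ b ∷ c ∷ [])

≢-forces-≡ : ∀ {x y z : Bool} → x ≢ y → z ≢ y → x ≡ z
≢-forces-≡ {false} {false} {_}     p q = ⊥-elim (p refl)
≢-forces-≡ {false} {true}  {false} p q = refl
≢-forces-≡ {false} {true}  {true}  p q = ⊥-elim (q refl)
≢-forces-≡ {true}  {false} {false} p q = ⊥-elim (q refl)
≢-forces-≡ {true}  {false} {true}  p q = refl
≢-forces-≡ {true}  {true}  {_}     p q = ⊥-elim (p refl)

find< : ∀ {P : ℕ → Set} → (∀ n → Dec (P n)) → ∀ N →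
        (∃ λ n → n < N × P n) ⊎ (∀ n → n < N → ¬ P n)
find< P? zero = inj₂ λ _ ()
find< {P} P? (suc N) with find< P? N | P? N
... | inj₁ (n , n<N , p) | _     = inj₁ (n , m<n⇒m<1+n n<N , p)
... | inj₂ _             | yes p = inj₁ (N , ≤-refl , p)
... | inj₂ none          | no ¬p = inj₂ go
  where
  go : ∀ n → n < suc N → ¬ P n
  go n n<1+N with m≤n⇒m<n∨m≡n (s≤s⁻¹ n<1+N)
  ... | inj₁ n<N  = none n n<N
  ... | inj₂ refl = ¬p

-- Strict growth makes the congruent values differ by a positive multiple of `d`. This yields two
-- windows, or two cuts of the image, whose distance is a multiple of a given period.
pigeonhole-% : ∀ d .{{_ : NonZero d}} (f : ℕ → ℕ) → (∀ n → f n < f (suc n)) →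
               ∃₂ λ m n → m < n × n ≤ d × ∃ λ q → f n ≡ f m + suc q * d
pigeonhole-% d f f-step with Fin.pigeonhole ≤-refl (λ (i : Fin (suc d)) → fromℕ< (m%n<n (f (toℕ i)) d))
... | i , j , i<j , same with f (toℕ j) / d ≤? f (toℕ i) / d
...   | yes le = contradiction (f-mono i<j) (≤⇒≯ f[j]≤f[i])
  where
  f-mono : ∀ {m n} → m < n → f m < f n
  f-mono {m} {suc n} (s≤s m≤n) with m≤n⇒m<n∨m≡n m≤n
  ... | inj₁ m<n  = <-trans (f-mono m<n) (f-step n)
  ... | inj₂ refl = f-step n
  f[j]≤f[i] : f (toℕ j) ≤ f (toℕ i)
  f[j]≤f[i] = begin
    f (toℕ j)                               ≡⟨ m≡m%n+[m/n]*n (f (toℕ j)) d ⟩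
    f (toℕ j) % d + f (toℕ j) / d * d       ≡⟨ cong (_+ f (toℕ j) / d * d) (sym (Fin.fromℕ<-injective _ _ _ _ same)) ⟩
    f (toℕ i) % d + f (toℕ j) / d * d       ≤⟨ +-monoʳ-≤ (f (toℕ i) % d) (*-monoˡ-≤ d le) ⟩
    f (toℕ i) % d + f (toℕ i) / d * d       ≡⟨ m≡m%n+[m/n]*n (f (toℕ i)) d ⟨
    f (toℕ i)                               ∎
    where open ≤-Reasoning
...   | no ≰ with m≤n⇒∃[o]m+o≡n (≰⇒> ≰)
...     | q , eq = toℕ i , toℕ j , i<j , s≤s⁻¹ (Fin.toℕ<n j) , q , (begin
    f (toℕ j)                                          ≡⟨ m≡m%n+[m/n]*n (f (toℕ j)) d ⟩
    f (toℕ j) % d + f (toℕ j) / d * d                  ≡⟨ cong₂ (λ r k → r + k * d) (sym (Fin.fromℕ<-injective _ _ _ _ same)) (sym eq) ⟩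
    f (toℕ i) % d + (suc (f (toℕ i) / d) + q) * d      ≡⟨ regroup (f (toℕ i) % d) (f (toℕ i) / d) ⟩
    (f (toℕ i) % d + f (toℕ i) / d * d) + suc q * d    ≡⟨ cong (_+ suc q * d) (m≡m%n+[m/n]*n (f (toℕ i)) d) ⟨
    f (toℕ i) + suc q * d                              ∎)
  where
  open ≡-Reasoning
  regroup : ∀ r k → r + (suc k + q) * d ≡ (r + k * d) + suc q * d
  regroup r k = solve (r ∷ k ∷ q ∷ d ∷ [])

upper-bound : ∀ {n} (f : Fin n → ℕ) → ∃ λ B → ∀ i → f i ≤ B
upper-bound {zero}  f = 0 , λ ()
upper-bound {suc n} f with upper-bound (f ∘ fsuc)
... | B , f≤B = f fzero ⊔ B , λ where
  fzero    → m≤m⊔n (f fzero) B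
  (fsuc i) → ≤-trans (f≤B i) (m≤n⊔m (f fzero) B)

-- Common prefixes and order of suffixes

record Agree (ω : Word) (n i j : ℕ) : Set where
  constructor agree
  field letter : ∀ l → l < n → ω (i + l) ≡ ω (j + l)
open Agree public

-- Two occurrences of a right special factor of length `n` with different continuations.
record Exact (ω : Word) (n i j : ℕ) : Set where
  constructor exact
  field
    agreement : Agree ω n i j
    differ    : ω (i + n) ≢ ω (j + n)
open Exact public

module _ {ω : Word} where

  Agree-at : ∀ {n i j x y} l → Agree ω n i j → l < n → x ≡ i + l → y ≡ j + l → ω x ≡ ω y
  Agree-at l A l<n refl refl = letter A l l<n

  Agree-refl : ∀ {n i} → Agree ω n i i
  Agree-refl = agree λ _ _ → refl

  Agree-sym : ∀ {n i j} → Agree ω n i j → Agree ω n j i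
  Agree-sym A = agree λ l l<n → sym (letter A l l<n)

  Agree-trans : ∀ {n i j k} → Agree ω n i j → Agree ω n j k → Agree ω n i k
  Agree-trans A B = agree λ l l<n → trans (letter A l l<n) (letter B l l<n)

  Agree-≤ : ∀ {m n i j} → m ≤ n → Agree ω n i j → Agree ω m i j
  Agree-≤ m≤n A = agree λ l l<m → letter A l (<-≤-trans l<m m≤n)

  Agree-shift : ∀ {n i j} d → Agree ω (d + n) i j → Agree ω n (i + d) (j + d)
  Agree-shift {n} {i} {j} d A = agree λ l l<n →
    Agree-at (d + l) A (+-monoʳ-< d l<n) (+-assoc i d l) (+-assoc j d l)

  Agree-append : ∀ {m n i j} → Agree ω m i j → Agree ω n (i + m) (j + m) → Agree ω (m + n) i j
  Agree-append {m} {n} {i} {j} A B = agree go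
    where
    go : ∀ l → l < m + n → ω (i + l) ≡ ω (j + l)
    go l l< with l <? m
    ... | yes l<m = letter A l l<m
    ... | no  l≮m with k , refl ← m≤n⇒∃[o]m+o≡n (≮⇒≥ l≮m) =
      Agree-at k B (+-cancelˡ-< m k n l<) (sym (+-assoc i m k)) (sym (+-assoc j m k))

  Agree-tail : ∀ {n i j} → Agree ω (suc n) i j → Agree ω n (suc i) (suc j)
  Agree-tail {n} {i} {j} A = agree λ l l<n →
    Agree-at (suc l) A (s≤s l<n) (sym (+-suc i l)) (sym (+-suc j l))

  Agree-head : ∀ {n i j} → Agree ω (suc n) i j → ω i ≡ ω j
  Agree-head {i = i} {j} A = Agree-at 0 A z<s (sym (+-identityʳ i)) (sym (+-identityʳ j))

  Agree-snoc : ∀ {n i j} → Agree ω n i j → ω (i + n) ≡ ω (j + n) → Agree ω (suc n) i j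
  Agree-snoc {n} {i} {j} A e = agree go
    where
    go : ∀ l → l < suc n → ω (i + l) ≡ ω (j + l)
    go l l<1+n with m≤n⇒m<n∨m≡n (s≤s⁻¹ l<1+n)
    ... | inj₁ l<n  = letter A l l<n
    ... | inj₂ refl = e

  Agree-cons : ∀ {n i j} → ω i ≡ ω j → Agree ω n (suc i) (suc j) → Agree ω (suc n) i j
  Agree-cons {n} {i} {j} e A = agree go
    where
    go : ∀ l → l < suc n → ω (i + l) ≡ ω (j + l)
    go zero    _         = subst₂ (λ x y → ω x ≡ ω y) (sym (+-identityʳ i)) (sym (+-identityʳ j)) e
    go (suc l) (s≤s l<n) = Agree-at l A l<n (+-suc i l) (+-suc j l)

  Exact-sym : ∀ {n i j} → Exact ω n i j → Exact ω n j i
  Exact-sym (exact A d) = exact (Agree-sym A) (d ∘ sym)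

  Exact-shift : ∀ {n i j} d → Exact ω (d + n) i j → Exact ω n (i + d) (j + d)
  Exact-shift {n} {i} {j} d (exact A ne) = exact (Agree-shift d A)
    λ e → ne (subst₂ (λ x y → ω x ≡ ω y) (+-assoc i d n) (+-assoc j d n) e)

  Exact-tail : ∀ {n i j} → Exact ω (suc n) i j → Exact ω n (suc i) (suc j)
  Exact-tail {n} {i} {j} (exact A ne) = exact (Agree-tail A)
    λ e → ne (subst₂ (λ x y → ω x ≡ ω y) (sym (+-suc i n)) (sym (+-suc j n)) e)

  first-mismatch : ∀ n i j → (∃ λ m → m < n × Exact ω m i j) ⊎ Agree ω n i j
  first-mismatch zero i j = inj₂ (agree λ _ ())
  first-mismatch (suc n) i j with first-mismatch n i j
  ... | inj₁ (m , m<n , E) = inj₁ (m , m<n⇒m<1+n m<n , E)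
  ... | inj₂ A with ω (i + n) Bool.≟ ω (j + n)
  ...   | yes e = inj₂ (Agree-snoc A e)
  ...   | no ne = inj₁ (n , ≤-refl , exact A ne)

  Exact⇒¬Agree : ∀ {m n i j} → m < n → Exact ω m i j → ¬ Agree ω n i j
  Exact⇒¬Agree {m} m<n E A = differ E (letter A m m<n)

  Agree? : ∀ n i j → Dec (Agree ω n i j)
  Agree? n i j with first-mismatch n i j
  ... | inj₁ (m , m<n , E) = no (Exact⇒¬Agree m<n E)
  ... | inj₂ A             = yes A

  Agree-¬snoc : ∀ {n i j} → Agree ω n i j → ¬ Agree ω (suc n) i j → Exact ω n i j
  Agree-¬snoc A ¬A = exact A λ e → ¬A (Agree-snoc A e)

  ¬Exact⇒snoc : ∀ {n i j} → Agree ω n i j → ¬ Exact ω n i j → Agree ω (suc n) i j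
  ¬Exact⇒snoc {n} {i} {j} A ¬E with ω (i + n) Bool.≟ ω (j + n)
  ... | yes e = Agree-snoc A e
  ... | no ne = ⊥-elim (¬E (exact A ne))

  Exact-other : ∀ {n i j x} → Exact ω n i j → Agree ω n x i → ¬ Agree ω (suc n) x i → Agree ω (suc n) x j
  Exact-other E A ¬A = Agree-snoc (Agree-trans A (agreement E))
    (≢-forces-≡ (λ e → ¬A (Agree-snoc A e)) (λ e → differ E (sym e)))

  -- One of the two continuations differs from that of `r`. It supplies the factor of length n + 1
  -- that is missed when each factor of length n is extended in one way only.
  Exact-avoid : ∀ {n x x′} → Exact ω n x x′ → ∀ r → ∃ λ z → Agree ω n x z × ¬ Agree ω (suc n) z r
  Exact-avoid {n} {x} {x′} E r with Agree? (suc n) x r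
  ... | no ¬A = x , Agree-refl , ¬A
  ... | yes A = x′ , agreement E , λ B → Exact⇒¬Agree ≤-refl E (Agree-trans A (Agree-sym B))

record Lt (ω : Word) (i j : ℕ) : Set where
  constructor lt
  field
    {position} : ℕ
    common     : Agree ω position i j
    low        : ω (i + position) ≡ false
    high       : ω (j + position) ≡ true
open Lt public

-- Counts the classes of an equivalence without forming a quotient: `rep` is a transversal. A factor
-- is represented by one of its occurrences.
record Classes (R : ℕ → ℕ → Set) (c : ℕ) : Set where
  field
    rep      : Fin c → ℕ
    rep-inj  : ∀ {k l} → R (rep k) (rep l) → k ≡ l
    class    : ℕ → Fin c
    classify : ∀ x → R x (rep (class x))

  collision : (∀ {x y} → R x y → R y x) → (∀ {x y z} → R x y → R y z → R x z) →
              ∀ {n} → c < n → (f : Fin n → ℕ) → ∃₂ λ k l → k <ᶠ l × R (f k) (f l)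
  collision R-sym R-trans c<n f with Fin.pigeonhole c<n (class ∘ f)
  ... | k , l , k<l , e = k , l , k<l ,
    R-trans (classify (f k)) (subst (λ c → R (rep c) (f l)) (sym e) (R-sym (classify (f l))))

module _ {ω : Word} where

  Exact⇒Lt : ∀ {n i j} → Exact ω n i j → Lt ω i j ⊎ Lt ω j i
  Exact⇒Lt {n} {i} {j} (exact A ne) with ω (i + n) in p | ω (j + n) in q
  ... | false | false = ⊥-elim (ne refl)
  ... | false | true  = inj₁ (lt A p q)
  ... | true  | false = inj₂ (lt (Agree-sym A) q p)
  ... | true  | true  = ⊥-elim (ne refl)

  Lt-asym : ∀ {i j} → Lt ω i j → Lt ω j i → ⊥
  Lt-asym (lt {m} A lo hi) (lt {n} B lo′ hi′) with <-cmp m n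
  ... | tri< m<n _ _    = case trans (sym hi) (trans (letter B m m<n) lo) of λ ()
  ... | tri≈ _ refl _   = case trans (sym hi) lo′ of λ ()
  ... | tri> _ _ n<m    = case trans (sym hi′) (trans (letter A n n<m) lo′) of λ ()

  Lt-trans : ∀ {i j k} → Lt ω i j → Lt ω j k → Lt ω i k
  Lt-trans (lt {m} A lo hi) (lt {n} B lo′ hi′) with <-cmp m n
  ... | tri< m<n _ _  = lt (Agree-trans A (Agree-≤ (<⇒≤ m<n) B)) lo (trans (sym (letter B m m<n)) hi)
  ... | tri≈ _ refl _ = case trans (sym hi) lo′ of λ ()
  ... | tri> _ _ n<m  = lt (Agree-trans (Agree-≤ (<⇒≤ n<m) A) B) (trans (letter A n n<m) lo′) hi′

  Lt-transport : ∀ {n i j i′ j′} (L : Lt ω i j) → position L < n → Agree ω n i i′ → Agree ω n j j′ → Lt ω i′ j′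
  Lt-transport (lt {m} A lo hi) m<n Ai Aj = lt
    (Agree-trans (Agree-sym (Agree-≤ (<⇒≤ m<n) Ai)) (Agree-trans A (Agree-≤ (<⇒≤ m<n) Aj)))
    (trans (sym (letter Ai m m<n)) lo)
    (trans (sym (letter Aj m m<n)) hi)

  Lt⇒Exact : ∀ {i j} (L : Lt ω i j) → Exact ω (position L) i j
  Lt⇒Exact (lt A lo hi) = exact A λ e → case trans (sym lo) (trans e hi) of λ ()

  -- 0^r1… < 0^(r-1)1…, so a suffix starting with 0 is smaller than the next one.
  ¬Lt-next : ∀ {x} → ω x ≡ false → ¬ Lt ω (suc x) x
  ¬Lt-next {x} e (lt {m} A lo hi) = case trans (sym hi) (trans (constant m ≤-refl) e) of λ ()
    where
    constant : ∀ l → l ≤ m → ω (x + l) ≡ ω x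
    constant zero    _   = cong ω (+-identityʳ x)
    constant (suc l) l<m = trans (cong ω (+-suc x l)) (trans (letter A l l<m) (constant l (<⇒≤ l<m)))

  ¬Lt-next′ : ∀ {x} → ω x ≡ true → ¬ Lt ω x (suc x)
  ¬Lt-next′ {x} e (lt {m} A lo hi) = case trans (sym lo) (trans (constant m ≤-refl) e) of λ ()
    where
    constant : ∀ l → l ≤ m → ω (x + l) ≡ ω x
    constant zero    _   = cong ω (+-identityʳ x)
    constant (suc l) l<m = trans (cong ω (+-suc x l)) (trans (sym (letter A l l<m)) (constant l (<⇒≤ l<m)))

Unique-lookup-injective : ∀ {A : Set} {xs : List A} → Unique xs → ∀ k l → List.lookup xs k ≡ List.lookup xs l → k ≡ l
Unique-lookup-injective (_ ∷ _)  fzero    fzero    e = refl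
Unique-lookup-injective (x∉ ∷ _) fzero    (fsuc l) e = ⊥-elim (All.lookup x∉ (∈-lookup l) e)
Unique-lookup-injective (x∉ ∷ _) (fsuc k) fzero    e = ⊥-elim (All.lookup x∉ (∈-lookup k) (sym e))
Unique-lookup-injective (_ ∷ u)  (fsuc k) (fsuc l) e = cong fsuc (Unique-lookup-injective u k l e)

lookup-ext : ∀ {A : Set} {n} (v w : Vec A n) → (∀ k → lookup v k ≡ lookup w k) → v ≡ w
lookup-ext v w e = trans (sym (Vec.tabulate∘lookup v)) (trans (Vec.tabulate-cong e) (Vec.tabulate∘lookup w))

factor-classes : ∀ {ω n c} → HasCard (Factor ω n) c → Classes (Agree ω n) c
factor-classes {ω} {n} (xs , unique , refl , iff) = record
  { rep      = occ
  ; rep-inj  = λ {k} {l} A → Unique-lookup-injective unique k l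
      (lookup-ext _ _ λ m → trans (occ-spec k m) (trans (letter A (toℕ m) (Fin.toℕ<n m)) (sym (occ-spec l m))))
  ; class    = λ x → index (factor∈ x)
  ; classify = λ x → agree λ l l<n → let m = fromℕ< l<n in begin
      ω (x + l)                                         ≡⟨ cong (λ l → ω (x + l)) (Fin.toℕ-fromℕ< l<n) ⟨
      ω (x + toℕ m)                                     ≡⟨ Vec.lookup∘tabulate (λ k → ω (x + toℕ k)) m ⟨
      lookup (factor x) m                               ≡⟨ cong (λ w → lookup w m) (lookup-index (factor∈ x)) ⟩
      lookup (List.lookup xs (index (factor∈ x))) m     ≡⟨ occ-spec (index (factor∈ x)) m ⟩
      ω (occ (index (factor∈ x)) + toℕ m)               ≡⟨ cong (λ l → ω (occ (index (factor∈ x)) + l)) (Fin.toℕ-fromℕ< l<n) ⟩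
      ω (occ (index (factor∈ x)) + l)                   ∎
  }
  where
  open ≡-Reasoning
  occurs : ∀ k → Factor ω n (List.lookup xs k)
  occurs k = Equivalence.from (iff _) (∈-lookup k)
  occ : Fin (length xs) → ℕ
  occ k = proj₁ (occurs k)
  occ-spec : ∀ k m → lookup (List.lookup xs k) m ≡ ω (occ k + toℕ m)
  occ-spec k = proj₂ (occurs k)
  factor : ℕ → Vec Bool n
  factor x = tabulate λ k → ω (x + toℕ k)
  factor∈ : ∀ x → factor x ∈ xs
  factor∈ x = Equivalence.to (iff _) (x , Vec.lookup∘tabulate (λ k → ω (x + toℕ k)))

-- Sturmian words: complexity, balance, recurrence

bit : Bool → ℕ
bit false = 0
bit true  = 1

-- Subtracting `d` repeatedly brings `x` below `i + d` without leaving the periodic stretch; `fuel`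
-- bounds the number of subtractions.
periodic-return : ∀ {ω i d n B} → 0 < d → (∀ l → l < B + n → ω (i + l) ≡ ω (i + d + l)) →
                  ∀ fuel x → x ≤ B → x ≤ fuel → ∃ λ y → y < i + d × Agree ω n x y
periodic-return {ω} {i} {d} {n} {B} 0<d periodic fuel x x≤B x≤fuel with x <? i + d
periodic-return {ω} {i} {d} {n} {B} 0<d periodic fuel x x≤B x≤fuel | yes x<i+d = x , x<i+d , Agree-refl
periodic-return {ω} {i} {d} {n} {B} 0<d periodic zero x x≤B x≤0 | no x≮i+d =
  ⊥-elim (x≮i+d (≤-<-trans x≤0 (<-≤-trans 0<d (m≤n+m d i))))
periodic-return {ω} {i} {d} {n} {B} 0<d periodic (suc fuel) x x≤B x≤fuel | no x≮i+d
  with k , refl ← m≤n⇒∃[o]m+o≡n (≮⇒≥ x≮i+d)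
  with y , y< , A ← periodic-return {ω} {i} {d} {n} {B} 0<d periodic fuel (i + k)
                      (lin (x≤B ⊕ z≤n {d}) (solve (i ∷ d ∷ k ∷ B ∷ [])))
                      (lin (x≤fuel ⊕ 0<d) (solve (i ∷ d ∷ k ∷ fuel ∷ [])))
  = y , y< , Agree-trans (agree λ l l<n → begin
      ω (i + d + k + l)      ≡⟨ cong ω (+-assoc (i + d) k l) ⟩
      ω (i + d + (k + l))    ≡⟨ periodic (k + l) (lin (x≤B ⊕ l<n ⊕ z≤n {i + d}) (solve (i ∷ d ∷ k ∷ l ∷ n ∷ B ∷ []))) ⟨
      ω (i + (k + l))        ≡⟨ cong ω (+-assoc i k l) ⟨
      ω (i + k + l)          ∎) A
  where open ≡-Reasoning

module Sturmian-word (s : Word) (sturmian : Sturmian s) where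

  classes : ∀ n → Classes (Agree s n) (suc n)
  classes n = factor-classes (sturmian n)

  agree-collision : ∀ n {c} → suc n < c → (f : Fin c → ℕ) → ∃₂ λ k l → k <ᶠ l × Agree s n (f k) (f l)
  agree-collision n = Classes.collision (classes n) Agree-sym Agree-trans

  -- A second right special class would give n + 3 factors of length n + 1.
  right-special-unique : ∀ {n x x′ y y′} → Exact s n x x′ → Exact s n y y′ → Agree s n x y
  right-special-unique {n} {x} {x′} {y} {y′} Ex Ey with Agree? n x y
  ... | yes A = A
  ... | no ¬A = ⊥-elim (clash (agree-collision (suc n) ≤-refl f))
    where
    open Classes (classes n)
    other : ∀ {x x′} → Exact s n x x′ → ∃ λ z → Agree s n x z × ¬ Agree s (suc n) z (rep (class x))
    other {x} E = Exact-avoid E (rep (class x))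
    zx = other Ex
    zy = other Ey
    f : Fin (suc (suc (suc n))) → ℕ
    f fzero           = proj₁ zx
    f (fsuc fzero)    = proj₁ zy
    f (fsuc (fsuc k)) = rep k
    not-rep : ∀ {x x′} (E : Exact s n x x′) k → ¬ Agree s (suc n) (proj₁ (other E)) (rep k)
    not-rep {x} E k A with refl ← rep-inj (Agree-trans (Agree-sym (classify x)) (Agree-trans (proj₁ (proj₂ (other E))) (Agree-≤ (n≤1+n n) A))) =
      proj₂ (proj₂ (other E)) A
    clash : (∃₂ λ k l → k <ᶠ l × Agree s (suc n) (f k) (f l)) → ⊥
    clash (fzero , fsuc fzero , _ , A) =
      ¬A (Agree-trans (proj₁ (proj₂ zx)) (Agree-trans (Agree-≤ (n≤1+n n) A) (Agree-sym (proj₁ (proj₂ zy)))))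
    clash (fzero , fsuc (fsuc k) , _ , A) = not-rep Ex k A
    clash (fsuc fzero , fsuc (fsuc k) , _ , A) = not-rep Ey k A
    clash (fsuc (fsuc k) , fsuc (fsuc l) , s≤s (s≤s k<l) , A) =
      Fin.<⇒≢ k<l (rep-inj (Agree-≤ (n≤1+n n) A))
    clash (fsuc fzero , fsuc fzero , s≤s () , _)
    clash (fsuc (fsuc k) , fsuc fzero , s≤s () , _)

  opaque
    -- Two of the n + 2 factors of length n + 1 share their prefix of length n.
    right-special-exists : ∀ n → ∃₂ λ x y → Exact s n x y
    right-special-exists n with agree-collision n ≤-refl (Classes.rep (classes (suc n)))
    ... | k , l , k<l , A = _ , _ , Agree-¬snoc A λ B → Fin.<⇒≢ k<l (Classes.rep-inj (classes (suc n)) B)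

  opaque
    -- A period `d` from `i` on would bring all i + d + 1 factors of length i + d to start before
    -- `i + d`. As `B` bounds the chosen occurrences, periodicity on a bounded stretch is enough for
    -- this, and the search is finite.
    aperiodic : ∀ i d → 0 < d → ∃ λ l → s (i + l) ≢ s (i + d + l)
    aperiodic i d 0<d with upper-bound (Classes.rep (classes (i + d)))
    ... | B , rep≤B with find< (λ l → ¬? (s (i + l) Bool.≟ s (i + d + l))) (B + (i + d))
    ...   | inj₁ (l , _ , ne) = l , ne
    ...   | inj₂ none = ⊥-elim (no-room (Fin.pigeonhole ≤-refl (λ k → fromℕ< (proj₁ (proj₂ (earlier k))))))
      where
      open Classes (classes (i + d))
      earlier : ∀ k → ∃ λ y → y < i + d × Agree s (i + d) (rep k) y
      earlier k = periodic-return 0<d (λ l l< → decidable-stable (s (i + l) Bool.≟ s (i + d + l)) (none l l<))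
        (rep k) (rep k) (rep≤B k) ≤-refl
      no-room : (∃₂ λ k l → k <ᶠ l × fromℕ< (proj₁ (proj₂ (earlier k))) ≡ fromℕ< (proj₁ (proj₂ (earlier l)))) → ⊥
      no-room (k , l , k<l , e) = Fin.<⇒≢ k<l (rep-inj (Agree-trans (proj₂ (proj₂ (earlier k)))
        (subst (λ y → Agree s (i + d) y (rep l)) (sym (Fin.fromℕ<-injective _ _ _ _ e)) (Agree-sym (proj₂ (proj₂ (earlier l)))))))

bit-gap : ∀ {x y} → bit x ≡ suc (bit y) → x ≡ true × y ≡ false
bit-gap {true}  {false} _ = refl , refl
bit-gap {false} {_}     ()
bit-gap {true}  {true}  ()

bit-inj : ∀ {x y} → bit x ≡ bit y → x ≡ y
bit-inj {false} {false} _ = refl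
bit-inj {true}  {true}  _ = refl

bit≤1 : ∀ x → bit x ≤ 1
bit≤1 false = z≤n
bit≤1 true  = ≤-refl

wt : Word → ℕ → ℕ → ℕ
wt ω i zero    = 0
wt ω i (suc n) = wt ω i n + bit (ω (i + n))

module _ {ω : Word} where

  wt-+ : ∀ i m n → wt ω i (m + n) ≡ wt ω i m + wt ω (i + m) n
  wt-+ i m zero    = trans (cong (wt ω i) (+-identityʳ m)) (sym (+-identityʳ _))
  wt-+ i m (suc n) = begin
    wt ω i (m + suc n)                                        ≡⟨ cong (wt ω i) (+-suc m n) ⟩
    wt ω i (m + n) + bit (ω (i + (m + n)))                    ≡⟨ cong₂ (λ w x → w + bit (ω x)) (wt-+ i m n) (sym (+-assoc i m n)) ⟩
    wt ω i m + wt ω (i + m) n + bit (ω (i + m + n))           ≡⟨ +-assoc (wt ω i m) _ _ ⟩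
    wt ω i m + (wt ω (i + m) n + bit (ω (i + m + n)))         ∎
    where open ≡-Reasoning

  wt-slide : ∀ i n → wt ω i n + bit (ω (i + n)) ≡ bit (ω i) + wt ω (suc i) n
  wt-slide i n = trans (wt-+ i 1 n) (cong₂ (λ x y → bit (ω x) + wt ω y n) (+-identityʳ i) (+-comm i 1))

  wt-agree : ∀ {n i j} → Agree ω n i j → wt ω i n ≡ wt ω j n
  wt-agree {zero}  A = refl
  wt-agree {suc n} A = cong₂ (λ w x → w + bit x) (wt-agree (Agree-≤ (n≤1+n n) A)) (letter A n ≤-refl)

  -- A `shadow` runs through the positions from `a` to `b`, jumping back to `a` when it reaches `b`;
  -- both `a + t` and `b + t` copy its forced continuation.
  forced-period : ∀ {n a b} → a < b → Agree ω n a b →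
    (∀ y → a ≤ y → y < b → ∀ z → Agree ω n y z → Agree ω (suc n) y z) →
    ∀ t → ω (a + t) ≡ ω (b + t)
  forced-period {n} {a} {b} a<b A₀ forced t =
    let y , a≤y , y<b , Aa , Ab = shadow t in
    trans (sym (Agree-head (forced y a≤y y<b _ Aa))) (Agree-head (forced y a≤y y<b _ Ab))
    where
    shadow : ∀ t → ∃ λ y → a ≤ y × y < b × Agree ω n y (a + t) × Agree ω n y (b + t)
    shadow zero = a , ≤-refl , a<b , subst (Agree ω n a) (sym (+-identityʳ a)) Agree-refl ,
                  subst (Agree ω n a) (sym (+-identityʳ b)) A₀
    shadow (suc t) with shadow t
    ... | y , a≤y , y<b , Aa , Ab
      with Aa′ ← subst (Agree ω n (suc y)) (sym (+-suc a t)) (Agree-tail (forced y a≤y y<b _ Aa))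
         | Ab′ ← subst (Agree ω n (suc y)) (sym (+-suc b t)) (Agree-tail (forced y a≤y y<b _ Ab))
      with m≤n⇒m<n∨m≡n y<b
    ...   | inj₁ 1+y<b = suc y , m≤n⇒m≤1+n a≤y , 1+y<b , Aa′ , Ab′
    ...   | inj₂ refl  = a , ≤-refl , a<b , Agree-trans A₀ Aa′ , Agree-trans A₀ Ab′

module Balance (s : Word) (sturmian : Sturmian s) where

  open Sturmian-word s sturmian

  -- x starts an occurrence of cwc and y one of dwd, for letters c ≠ d.
  record Unbalanced (m x y : ℕ) : Set where
    field
      middle : Agree s m (suc x) (suc y)
      first  : s x ≢ s y
      last-x : s (x + suc m) ≡ s x
      last-y : s (y + suc m) ≡ s y

    branch : Exact s m (suc x) (suc y)
    branch = exact middle λ e → first (trans (sym last-x)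
      (trans (cong s (+-suc x m)) (trans e (trans (sym (cong s (+-suc y m))) last-y))))

  open Unbalanced

  flip : ∀ {m x y} → Unbalanced m x y → Unbalanced m y x
  flip U = record { middle = Agree-sym (middle U) ; first = first U ∘ sym ; last-x = last-y U ; last-y = last-x U }

  BalancedUpTo : ℕ → Set
  BalancedUpTo m = ∀ l → l ≤ m → ∀ i j → wt s i l ≤ suc (wt s j l)

  -- An occurrence of dw at distance l inside cwc makes w have period l, and then the
  -- first l letters of cwc and the last l letters of dwd have weights differing by 2.
  no-overlap : ∀ {m x y} → BalancedUpTo m → Unbalanced m x y → ∀ l → l ≤ suc m → ¬ Agree s (suc m) (x + l) y
  no-overlap {m} {x} {y} bal U zero l≤ A = first U (trans (cong s (sym (+-identityʳ x))) (Agree-head A))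
  no-overlap {m} {x} {y} bal U (suc k) l≤ A with m≤n⇒m<n∨m≡n l≤
  ... | inj₂ refl = first U (trans (sym (last-x U)) (Agree-head A))
  ... | inj₁ l≤m with m≤n⇒∃[o]m+o≡n (s≤s⁻¹ l≤m)
  ...   | r , refl = clash (s x) refl (s y) refl
    where
    l = suc k
    w-period : Agree s m (suc x) (suc x + l)
    w-period = Agree-trans (middle U) (Agree-sym (Agree-tail A))
    -- The first window of cwc and the last window of dwd each differ from `P` by one, in opposite
    -- directions; `P` is the common weight of the windows of length l at the relevant places of w,
    -- which has period l.
    P = wt s (suc x) l
    x-window : wt s x l + bit (s y) ≡ bit (s x) + P
    x-window = trans (cong (λ c → wt s x l + bit c) (sym (Agree-head A))) (wt-slide x l)
    after-w : wt s (suc x + m) l ≡ P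
    after-w = +-cancelˡ-≡ (wt s (suc x) m) _ _ (begin
      wt s (suc x) m + wt s (suc x + m) l     ≡⟨ wt-+ (suc x) m l ⟨
      wt s (suc x) (m + l)                    ≡⟨ cong (wt s (suc x)) (+-comm m l) ⟩
      wt s (suc x) (l + m)                    ≡⟨ wt-+ (suc x) l m ⟩
      P + wt s (suc x + l) m                  ≡⟨ cong (P +_) (wt-agree w-period) ⟨
      P + wt s (suc x) m                      ≡⟨ +-comm P _ ⟩
      wt s (suc x) m + P                      ∎)
      where open ≡-Reasoning
    r+l : r + l ≡ m
    r+l = +-comm r l
    w-end : wt s (suc y + r) l ≡ P
    w-end = begin
      wt s (suc y + r) l        ≡⟨ wt-agree (Agree-shift r (subst (λ m → Agree s m (suc x) (suc y)) (sym r+l) (middle U))) ⟨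
      wt s (suc x + r) l        ≡⟨ wt-agree (Agree-shift r (subst (λ m → Agree s m (suc x) (suc x + l)) (sym r+l) w-period)) ⟩
      wt s (suc x + l + r) l    ≡⟨ cong (λ z → wt s z l) (+-assoc (suc x) l r) ⟩
      wt s (suc x + m) l        ≡⟨ after-w ⟩
      P                         ∎
      where open ≡-Reasoning
    r<m : r < m
    r<m = m<n+m r z<s
    last-w : s (suc y + r) ≡ s x
    last-w = begin
      s (suc y + r)         ≡⟨ letter (middle U) r r<m ⟨
      s (suc x + r)         ≡⟨ letter w-period r r<m ⟩
      s (suc x + l + r)     ≡⟨ cong s (trans (+-assoc (suc x) l r) (sym (+-suc x m))) ⟩
      s (x + suc m)         ≡⟨ last-x U ⟩
      s x                   ∎
      where open ≡-Reasoning
    Q = wt s (suc (suc y + r)) l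
    y-window : P + bit (s y) ≡ bit (s x) + Q
    y-window = begin
      P + bit (s y)                                   ≡⟨ cong₂ (λ p c → p + bit c) (sym w-end) (trans (sym (last-y U)) (cong s y-end)) ⟩
      wt s (suc y + r) l + bit (s (suc y + r + l))    ≡⟨ wt-slide (suc y + r) l ⟩
      bit (s (suc y + r)) + Q                         ≡⟨ cong (λ c → bit c + Q) last-w ⟩
      bit (s x) + Q                                   ∎
      where
      open ≡-Reasoning
      y-end : y + suc (suc k + r) ≡ suc y + r + suc k
      y-end = solve (y ∷ k ∷ r ∷ [])
    l≤m′ : l ≤ m
    l≤m′ = m≤m+n l r
    clash : ∀ c → s x ≡ c → ∀ d → s y ≡ d → ⊥
    clash false ex false ey = first U (trans ex (sym ey))
    clash true  ex true  ey = first U (trans ex (sym ey))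
    clash true  ex false ey = <⇒≱ (≤-reflexive (sym (gap (wt s x l) P Q
      (subst₂ (λ a b → wt s x l + bit b ≡ bit a + P) ex ey x-window)
      (subst₂ (λ a b → P + bit b ≡ bit a + Q) ex ey y-window)))) (bal l l≤m′ x (suc (suc y + r)))
      where
      gap : ∀ u p q → u + 0 ≡ 1 + p → p + 0 ≡ 1 + q → u ≡ 2 + q
      gap u p q e₁ e₂ = lin≡ (cong₂ _+_ e₁ e₂) (solve (u ∷ p ∷ q ∷ []))
    clash false ex true  ey = <⇒≱ (≤-reflexive (sym (gap (wt s x l) P Q
      (subst₂ (λ a b → wt s x l + bit b ≡ bit a + P) ex ey x-window)
      (subst₂ (λ a b → P + bit b ≡ bit a + Q) ex ey y-window)))) (bal l l≤m′ (suc (suc y + r)) x)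
      where
      gap : ∀ u p q → u + 1 ≡ 0 + p → p + 1 ≡ 0 + q → q ≡ 2 + u
      gap u p q e₁ e₂ = sym (lin≡ (cong₂ _+_ e₁ e₂) (solve (u ∷ p ∷ q ∷ [])))

  -- A right special factor of length m + 1 ends with w, so at `x`, ..., `x + suc m` it could only
  -- be dw, excluded by `no-overlap`, or cw, excluded by assumption. Hence all these positions are
  -- deterministic. Together with `y` they are m + 3 positions for m + 2 factors; `y` agrees with
  -- none of the others, and two of the others agreeing would make the word periodic.
  must-branch : ∀ {m x y} → BalancedUpTo m → Unbalanced m x y → ¬ (∀ z → ¬ Exact s (suc m) x z)
  must-branch {m} {x} {y} bal U never = contra (agree-collision (suc m) ≤-refl f)
    where
    forced : ∀ l → l ≤ suc m → ∀ z → Agree s (suc m) (x + l) z → Agree s (suc (suc m)) (x + l) z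
    forced l l≤ z A = ¬Exact⇒snoc A no-exact
      where
      no-exact : ¬ Exact s (suc m) (x + l) z
      no-exact E with s (x + l) Bool.≟ s x
                    | right-special-unique (branch U) (Exact-tail E)
      ... | no ne | B = no-overlap bal U l l≤
              (Agree-cons (≢-forces-≡ ne (first U ∘ sym)) (Agree-trans (Agree-sym B) (middle U)))
      ... | yes e | B with Agree? (suc (suc m)) x (x + l)
      ...   | no ¬A = never (x + l) (Agree-¬snoc (Agree-cons (sym e) B) ¬A)
      ...   | yes A′ = never z (Agree-¬snoc (Agree-trans (Agree-≤ (n≤1+n _) A′) A)
                λ A″ → Exact⇒¬Agree ≤-refl E (Agree-trans (Agree-sym A′) A″))
    f : Fin (suc (suc (suc m))) → ℕ
    f fzero    = y
    f (fsuc k) = x + toℕ k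
    contra : (∃₂ λ k l → k <ᶠ l × Agree s (suc m) (f k) (f l)) → ⊥
    contra (fzero , fsuc l , _ , A) = no-overlap bal U (toℕ l) (s≤s⁻¹ (Fin.toℕ<n l)) (Agree-sym A)
    contra (fsuc k , fsuc l , s≤s k<l , A) with m≤n⇒∃[o]m+o≡n k<l
    ... | e , eq = let t , ne = aperiodic (x + toℕ k) (suc e) z<s in
      ne (trans (forced-period (+-monoʳ-< x k<l) A forced′ t)
                (cong (λ z → s (z + t)) (trans (cong (x +_) (trans (sym eq) (sym (+-suc (toℕ k) e)))) (sym (+-assoc x (toℕ k) (suc e))))))
      where
      forced′ : ∀ y → x + toℕ k ≤ y → y < x + toℕ l → ∀ z → Agree s (suc m) y z → Agree s (suc (suc m)) y z
      forced′ y lo hi with m≤n⇒∃[o]m+o≡n (≤-trans (m≤m+n x (toℕ k)) lo)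
      ... | o , refl = forced o (≤-trans (<⇒≤ (+-cancelˡ-< x o (toℕ l) hi)) (s≤s⁻¹ (Fin.toℕ<n l)))

  -- At a shortest unbalanced length all proper nonempty prefixes of the two windows differ in
  -- weight by exactly one, so the windows are 1w1 and 0w0. Then 1w and 0w would both be right
  -- special.
  balanced-step : ∀ m → BalancedUpTo (suc m) → ∀ i j → wt s i (suc (suc m)) ≤ suc (wt s j (suc (suc m)))
  balanced-step m bal i j with wt s i (suc (suc m)) ≤? suc (wt s j (suc (suc m)))
  ... | yes le = le
  ... | no ≰ = ⊥-elim (must-branch (λ l l≤m → bal l (m≤n⇒m≤1+n l≤m)) U λ z Ez →
                       must-branch (λ l l≤m → bal l (m≤n⇒m≤1+n l≤m)) (flip U) λ z′ Ez′ →
                       first U (Agree-head (right-special-unique Ez Ez′)))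
    where
    n = suc (suc m)
    gap : 2 + wt s j n ≤ wt s i n
    gap = ≰⇒> ≰
    prefix : ∀ l → 0 < l → l < n → wt s i l ≡ suc (wt s j l)
    prefix l 0<l l<n with m≤n⇒∃[o]m+o≡n (<⇒≤ l<n)
    ... | r , eq = ≤-antisym (bal l (s≤s⁻¹ l<n) i j) (lower _ _ _ _ _ _
            gap (trans (cong (wt s i) (sym eq)) (wt-+ i l r)) (trans (cong (wt s j) (sym eq)) (wt-+ j l r))
            (bal r (s≤s⁻¹ (subst (r <_) eq (m<n+m r 0<l))) (i + l) (j + l)))
      where
      lower : ∀ a b p q u v → 2 + a ≤ b → b ≡ p + u → a ≡ q + v → u ≤ suc v → suc q ≤ p
      lower a b p q u v h refl refl k = lin (h ⊕ k) (solve (p ∷ q ∷ u ∷ v ∷ []))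
    ends : s i ≡ true × s j ≡ false
    ends = bit-gap (subst₂ (λ x y → bit (s x) ≡ suc (bit (s y))) (+-identityʳ i) (+-identityʳ j) (prefix 1 z<s (s≤s z<s)))
    inner : Agree s m (suc i) (suc j)
    inner = agree λ l l<m → subst₂ (λ x y → s x ≡ s y) (+-suc i l) (+-suc j l)
      (bit-inj (same _ _ _ _ (prefix (suc l) z<s (s≤s (m<n⇒m<1+n l<m))) (prefix (suc (suc l)) z<s (s≤s (s≤s l<m)))))
      where
      same : ∀ p q c d → p ≡ suc q → p + c ≡ suc (q + d) → c ≡ d
      same p q c d refl e = lin≡ e (solve (q ∷ c ∷ d ∷ []))
    last-letters : s (i + suc m) ≡ true × s (j + suc m) ≡ false
    last-letters = bit-gap (≤-antisym
      (≤-trans (bit≤1 _) (s≤s z≤n))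
      (final _ _ _ _ gap (prefix (suc m) z<s ≤-refl)))
      where
      final : ∀ p q c d → 2 + (q + d) ≤ p + c → p ≡ suc q → suc d ≤ c
      final p q c d h refl = lin h (solve (q ∷ c ∷ d ∷ []))
    U : Unbalanced m i j
    U = record
      { middle = inner
      ; first  = λ e → case trans (sym (proj₁ ends)) (trans e (proj₂ ends)) of λ ()
      ; last-x = trans (proj₁ last-letters) (sym (proj₁ ends))
      ; last-y = trans (proj₂ last-letters) (sym (proj₂ ends))
      }

  balancedUpTo : ∀ m → BalancedUpTo m
  balancedUpTo zero zero _ i j = z≤n
  balancedUpTo (suc m) l l≤ i j with m≤n⇒m<n∨m≡n l≤
  ... | inj₁ l≤m  = balancedUpTo m l (s≤s⁻¹ l≤m) i j
  balancedUpTo (suc zero)    l l≤ i j | inj₂ refl = ≤-trans (bit≤1 _) (s≤s z≤n)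
  balancedUpTo (suc (suc m)) l l≤ i j | inj₂ refl = balanced-step m (balancedUpTo (suc m)) i j

  balanced : ∀ n i j → wt s i n ≤ suc (wt s j n)
  balanced n = balancedUpTo n n ≤-refl

-- Bounded powers and uniform recurrence

module _ {ω : Word} where

  period-wt : ∀ {x d} e → Agree ω e x (x + d) → wt ω (x + e) d ≡ wt ω x d
  period-wt {x} {d} e A = +-cancelˡ-≡ (wt ω x e) _ _ (begin
    wt ω x e + wt ω (x + e) d    ≡⟨ wt-+ x e d ⟨
    wt ω x (e + d)               ≡⟨ cong (wt ω x) (+-comm e d) ⟩
    wt ω x (d + e)               ≡⟨ wt-+ x d e ⟩
    wt ω x d + wt ω (x + d) e    ≡⟨ cong (wt ω x d +_) (wt-agree A) ⟨
    wt ω x d + wt ω x e          ≡⟨ +-comm (wt ω x d) _ ⟩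
    wt ω x e + wt ω x d          ∎)
    where open ≡-Reasoning

  wt-blocks : ∀ {x d} k → Agree ω (k * d) x (x + d) → wt ω x (k * d) ≡ k * wt ω x d
  wt-blocks {x} {d} zero    A = refl
  wt-blocks {x} {d} (suc k) A = trans (wt-+ x d (k * d)) (cong (wt ω x d +_)
    (trans (sym (wt-agree A′)) (wt-blocks k A′)))
    where
    A′ : Agree ω (k * d) x (x + d)
    A′ = Agree-≤ (m≤n+m (k * d) d) A

  wt-blocks-≥ : ∀ {d h} → (∀ x → h ≤ wt ω x d) → ∀ k x → k * h ≤ wt ω x (k * d)
  wt-blocks-≥ {d} lower zero    x = z≤n
  wt-blocks-≥ {d} lower (suc k) x = ≤-trans (+-mono-≤ (lower x) (wt-blocks-≥ lower k (x + d))) (≤-reflexive (sym (wt-+ x d (k * d))))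

  wt-blocks-≤ : ∀ {d h} → (∀ x → wt ω x d ≤ h) → ∀ k x → wt ω x (k * d) ≤ k * h
  wt-blocks-≤ {d} upper zero    x = z≤n
  wt-blocks-≤ {d} upper (suc k) x = ≤-trans (≤-reflexive (wt-+ x d (k * d))) (+-mono-≤ (upper x) (wt-blocks-≤ upper k (x + d)))

  wt-ends : ∀ x d q → wt ω x (suc (suc q) * d) ≡ wt ω x d + wt ω (x + d) (q * d) + wt ω (x + suc q * d) d
  wt-ends x d q = begin
    wt ω x (suc (suc q) * d)                                          ≡⟨ cong (wt ω x) (+-comm d (suc q * d)) ⟩
    wt ω x (suc q * d + d)                                            ≡⟨ wt-+ x (suc q * d) d ⟩
    wt ω x (suc q * d) + wt ω (x + suc q * d) d                       ≡⟨ cong (_+ wt ω (x + suc q * d) d) (wt-+ x d (q * d)) ⟩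
    wt ω x d + wt ω (x + d) (q * d) + wt ω (x + suc q * d) d          ∎
    where open ≡-Reasoning

-- Bounded powers in quantitative form: a factor with period d ≤ D is shorter than `modulus D + d`.
record UniformlyAperiodic (ω : Word) : Set where
  field
    modulus     : ℕ → ℕ
    not-agree   : ∀ {D d i} → 0 < d → d ≤ D → ¬ Agree ω (modulus D) i (i + d)

module Recurrence (s : Word) (sturmian : Sturmian s) where

  open Sturmian-word s sturmian
  open Balance s sturmian using (balanced)

  -- Where the comparison with the shift by d breaks, the weight of a window of length d
  -- goes up by one in the first case and down by one in the second.
  no-swap : ∀ {x y d} → wt s x d ≡ wt s y d → Lt s x (x + d) → Lt s (y + d) y → ⊥
  no-swap {x} {y} {d} same (lt {e} A lo hi) (lt {e′} A′ lo′ hi′) =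
    absurd _ _ _ _ _ (period-wt e A) (period-wt e′ (Agree-sym A′)) same
      (subst₂ (λ b c → wt s (x + e) d + bit b ≡ bit c + wt s (suc (x + e)) d) (trans (cong s (+-swapʳ x e d)) hi) lo (wt-slide (x + e) d))
      (subst₂ (λ b c → wt s (y + e′) d + bit b ≡ bit c + wt s (suc (y + e′)) d) (trans (cong s (+-swapʳ y e′ d)) lo′) hi′ (wt-slide (y + e′) d))
      (balanced d (suc (x + e)) (suc (y + e′)))
    where
    absurd : ∀ u u′ v v′ p {q} → u ≡ p → v ≡ q → p ≡ q → u + 1 ≡ 0 + u′ → v + 0 ≡ 1 + v′ → u′ ≤ suc v′ → ⊥
    absurd u u′ v v′ p refl refl refl e₁ e₂ h = 1+n≰n {p} (lin (≤-reflexive e₁ ⊕ ≤-reflexive (sym e₂) ⊕ h) (solve (p ∷ u′ ∷ v′ ∷ [])))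

  module Windows (d : ℕ) (0<d : 0 < d) where

    change : ∀ {x} → s x ≢ s (x + d) →
      wt s (suc x) d ≡ suc (wt s x d) ⊎ wt s x d ≡ suc (wt s (suc x) d)
    change {x} ne with s x | s (x + d) | wt-slide {s} x d
    ... | false | false | _ = ⊥-elim (ne refl)
    ... | true  | true  | _ = ⊥-elim (ne refl)
    ... | false | true  | e = inj₁ (trans (sym e) (+-comm _ 1))
    ... | true  | false | e = inj₂ (trans (sym (+-identityʳ _)) e)

    next-change : ∀ x → ∃ λ y → x ≤ y × (wt s (suc y) d ≡ suc (wt s y d) ⊎ wt s y d ≡ suc (wt s (suc y) d))
    next-change x with aperiodic x d 0<d
    ... | l , ne = x + l , m≤m+n x l , change λ e → ne (trans e (cong s (+-swapʳ x l d)))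

    opaque
      -- A mismatch between the word and its shift by `d` changes the weight of the window by one.
      -- By balance no third weight occurs.
      two-values : ∃ λ h → (∃ λ x → wt s x d ≡ h) × (∃ λ x → wt s x d ≡ suc h)
      two-values with next-change 0
      ... | y , _ , inj₁ e = _ , (y , refl) , (suc y , e)
      ... | y , _ , inj₂ e = _ , (suc y , refl) , (y , e)

    h = proj₁ two-values

    upper : ∀ x → wt s x d ≤ suc h
    upper x = let y , e = proj₁ (proj₂ two-values) in subst (λ h → wt s x d ≤ suc h) e (balanced d x y)

    lower : ∀ x → h ≤ wt s x d
    lower x = let y , e = proj₂ (proj₂ two-values) in s≤s⁻¹ (subst (_≤ suc (wt s x d)) e (balanced d y x))

    opaque
      -- At a change, two adjacent windows carry both weights, and changes occur arbitrarily far.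
      next-value : ∀ v → v ≡ h ⊎ v ≡ suc h → ∀ x → ∃ λ y → x ≤ y × wt s y d ≡ v
      next-value v v∈ x with next-change x
      next-value v (inj₁ refl) x | y , x≤y , inj₁ e = y , x≤y , ≤-antisym (s≤s⁻¹ (subst (_≤ suc h) e (upper (suc y)))) (lower y)
      next-value v (inj₂ refl) x | y , x≤y , inj₁ e = suc y , m≤n⇒m≤1+n x≤y , ≤-antisym (upper (suc y)) (subst (suc h ≤_) (sym e) (s≤s (lower y)))
      next-value v (inj₁ refl) x | y , x≤y , inj₂ e = suc y , m≤n⇒m≤1+n x≤y , ≤-antisym (s≤s⁻¹ (subst (_≤ suc h) e (upper y))) (lower (suc y))
      next-value v (inj₂ refl) x | y , x≤y , inj₂ e = y , x≤y , ≤-antisym (upper y) (subst (suc h ≤_) (sym e) (s≤s (lower (suc y))))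

    opaque
      congruent-pair : ∀ v → v ≡ h ⊎ v ≡ suc h → ∃₂ λ x q → wt s x d ≡ v × wt s (x + suc q * d) d ≡ v
      congruent-pair v v∈ =
        let m , n , _ , _ , q , e = pigeonhole-% d {{>-nonZero 0<d}} f f-step in
        f m , q , value m , trans (cong (λ x → wt s x d) (sym e)) (value n)
        where
        f : ℕ → ℕ
        f zero    = proj₁ (next-value v v∈ 0)
        f (suc n) = proj₁ (next-value v v∈ (suc (f n)))
        f-step : ∀ n → f n < f (suc n)
        f-step n = proj₁ (proj₂ (next-value v v∈ (suc (f n))))
        value : ∀ n → wt s (f n) d ≡ v
        value zero    = proj₂ (proj₂ (next-value v v∈ 0))
        value (suc n) = proj₂ (proj₂ (next-value v v∈ (suc (f n))))

    -- Of the q + 2 adjacent windows from `x`, the first and the last weigh h + 1 and the others at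
    -- least h, in total at least (q + 2)h + 2. A run of period `d` with windows of weight h weighs
    -- only (q + 2)h over the same length, against balance.
    low-run : ∀ x q i → wt s x d ≡ suc h → wt s (x + suc q * d) d ≡ suc h → wt s i d ≡ h →
              ¬ Agree s (suc (suc q) * d) i (i + d)
    low-run x q i e₁ e₂ e A = absurd (wt s i (suc (suc q) * d)) (wt s x (suc (suc q) * d)) (wt s (x + d) (q * d)) h
      (wt-blocks (suc (suc q)) A) e (wt-ends x d q) e₁ e₂ (wt-blocks-≥ lower q (x + d)) (balanced (suc (suc q) * d) x i)
      where
      absurd : ∀ w w′ b h {a c p} → w ≡ suc (suc q) * p → p ≡ h → w′ ≡ a + b + c → a ≡ suc h → c ≡ suc h →
               q * h ≤ b → w′ ≤ suc w → ⊥
      absurd w w′ b h refl refl refl refl refl k l = 1+n≰n {0} (lin (k ⊕ l) (solve (q ∷ h ∷ b ∷ [])))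

    high-run : ∀ x q i → wt s x d ≡ h → wt s (x + suc q * d) d ≡ h → wt s i d ≡ suc h →
               ¬ Agree s (suc (suc q) * d) i (i + d)
    high-run x q i e₁ e₂ e A = absurd (wt s i (suc (suc q) * d)) (wt s x (suc (suc q) * d)) (wt s (x + d) (q * d)) (suc h) h
      (wt-blocks (suc (suc q)) A) e (wt-ends x d q) e₁ e₂ ≤-refl (wt-blocks-≤ upper q (x + d)) (balanced (suc (suc q) * d) i x)
      where
      absurd : ∀ w w′ b g h {a c p} → w ≡ suc (suc q) * p → p ≡ g → w′ ≡ a + b + c → a ≡ h → c ≡ h →
               h < g → b ≤ q * g → w ≤ suc w′ → ⊥
      absurd w w′ b g h refl refl refl refl refl h<g k l =
        1+n≰n {0} (lin (k ⊕ l ⊕ h<g ⊕ h<g) (solve (q ∷ g ∷ h ∷ b ∷ [])))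

    opaque
      bound : ∃ λ V → ∀ i → ¬ Agree s V i (i + d)
      bound with congruent-pair h (inj₁ refl) | congruent-pair (suc h) (inj₂ refl)
      ... | x , q , e₁ , e₂ | x′ , q′ , e₁′ , e₂′ = V ⊔ V′ , contra
        where
        V V′ : ℕ
        V  = suc (suc q) * d
        V′ = suc (suc q′) * d
        contra : ∀ i → ¬ Agree s (V ⊔ V′) i (i + d)
        contra i A with m≤n⇒m<n∨m≡n (lower i)
        ... | inj₂ h≡ = low-run x′ q′ i e₁′ e₂′ (sym h≡) (Agree-≤ (m≤n⊔m V V′) A)
        ... | inj₁ h< = high-run x q i e₁ e₂ (≤-antisym (upper i) h<) (Agree-≤ (m≤m⊔n V V′) A)

  opaque
    uniformly-aperiodic : UniformlyAperiodic s
    uniformly-aperiodic = record { modulus = V ; not-agree = λ {D} → not-agree D }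
      where
      V : ℕ → ℕ
      V zero    = 0
      V (suc D) = proj₁ (Windows.bound (suc D) z<s) ⊔ V D
      not-agree : ∀ D {d i} → 0 < d → d ≤ D → ¬ Agree s (V D) i (i + d)
      not-agree zero    0<d z≤n A = case 0<d of λ ()
      not-agree (suc D) {d} {i} 0<d d≤ A with m≤n⇒m<n∨m≡n d≤
      ... | inj₁ d≤D  = not-agree D 0<d (s≤s⁻¹ d≤D) (Agree-≤ (m≤n⊔m _ _) A)
      ... | inj₂ refl = proj₂ (Windows.bound (suc D) z<s) i (Agree-≤ (m≤m⊔n _ _) A)

  -- If x does not recur as a factor of length n + 1, then between its recurrences as a factor
  -- of length n the word is deterministic, hence periodic.
  opaque
    recurrent : ∀ n → ∃ λ W → ∀ x i → ∃ λ k → k < W × Agree s n x (i + k)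
    recurrent zero = 1 , λ x i → 0 , ≤-refl , agree λ _ ()
    recurrent (suc n) with recurrent n
    -- Within `W` positions the prefix of length n of `x` recurs; two of n + 2 consecutive positions
    -- agree on n letters; from there the forced run has to reach length `V`.
    ... | W , recur = W + (suc n + V) , step
      where
      open UniformlyAperiodic uniformly-aperiodic
      V : ℕ
      V = modulus (suc n)
      step : ∀ x i → ∃ λ k → k < W + (suc n + V) × Agree s (suc n) x (i + k)
      step x i with find< (λ k → Agree? {s} (suc n) x (i + k)) (W + (suc n + V))
      ... | inj₁ found = found
      ... | inj₂ none  = ⊥-elim contra
        where
        branch : ∃ λ k → Exact s n x (i + k)
        branch with recur x i
        ... | k , k<W , A = k , Agree-¬snoc A (none k (<-≤-trans k<W (m≤m+n W _)))
        forced : ∀ k l → k < suc n + V → l < suc n + V → Agree s n (i + k) (i + l) → Agree s (suc n) (i + k) (i + l)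
        forced k l k< l< A = ¬Exact⇒snoc A λ E →
          let xk = right-special-unique (proj₂ branch) E
              E′ = Agree-¬snoc xk (none k (<-≤-trans k< (m≤n+m _ W)))
          in none l (<-≤-trans l< (m≤n+m _ W)) (Exact-other E xk (Exact⇒¬Agree ≤-refl E′))
        contra : ⊥
        contra with agree-collision n {suc (suc n)} ≤-refl (λ k → i + toℕ k)
        ... | k , l , k<l , A with m≤n⇒∃[o]m+o≡n k<l
        ...   | e , eq = not-agree {suc n} {suc e} {i + toℕ k} z<s
                  (≤-trans (s≤s (m≤n+m e (toℕ k))) (≤-trans (≤-reflexive eq) (s≤s⁻¹ (Fin.toℕ<n l))))
                  (agree λ t t<V → trans (cong s (+-assoc i (toℕ k) t)) (trans (Agree-head (run t t<V)) (cong s (position-l t))))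
          where
          position-l : ∀ t → i + (toℕ l + t) ≡ i + toℕ k + suc e + t
          position-l t = trans (cong (λ l → i + (l + t)) (sym eq)) (rearrange (toℕ k))
            where
            rearrange : ∀ k → i + (suc k + e + t) ≡ i + k + suc e + t
            rearrange k = solve (i ∷ k ∷ e ∷ t ∷ [])
          in-range : ∀ {t} → t < V → ∀ (k : Fin (suc (suc n))) → toℕ k + t < suc n + V
          in-range t<V k = +-mono-≤-< (s≤s⁻¹ (Fin.toℕ<n k)) t<V
          run : ∀ t → t < V → Agree s (suc n) (i + (toℕ k + t)) (i + (toℕ l + t))
          run zero t<V = forced _ _ (in-range t<V k) (in-range t<V l)
            (subst₂ (λ x y → Agree s n (i + x) (i + y)) (sym (+-identityʳ (toℕ k))) (sym (+-identityʳ (toℕ l))) A)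
          run (suc t) t<V = forced _ _ (in-range t<V k) (in-range t<V l)
            (subst₂ (Agree s n) (forward (toℕ k)) (forward (toℕ l)) (Agree-tail (run t (<-trans (n<1+n t) t<V))))
            where
            forward : ∀ k → suc (i + (k + t)) ≡ i + (k + suc t)
            forward k = solve (i ∷ k ∷ t ∷ [])

-- Parsing the image into blocks

-- `cut i` is the length of T(s_0...s_(i-1)), and `image c o` has a meaning for `o < len c` only.
-- Markedness enters as `first-inj` and `last-inj`: a first or last letter identifies its block.
record MarkedImage (s ω : Word) : Set where
  field
    len         : Bool → ℕ
    image       : Bool → ℕ → Bool
    len>0       : ∀ c → 0 < len c
    first-inj   : ∀ {c d} → image c 0 ≡ image d 0 → c ≡ d
    last-inj    : ∀ {c d m n} → suc m ≡ len c → suc n ≡ len d → image c m ≡ image d n → c ≡ d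
    cut         : ℕ → ℕ
    cut-zero    : cut 0 ≡ 0
    cut-suc     : ∀ i → cut (suc i) ≡ cut i + len (s i)
    letter-at   : ∀ i o → o < len (s i) → ω (cut i + o) ≡ image (s i) o

module Image {s ω : Word} (I : MarkedImage s ω) where

  open MarkedImage I

  next : ℕ × ℕ → ℕ × ℕ
  next (i , o) with suc o <? len (s i)
  ... | yes _ = i , suc o
  ... | no  _ = suc i , 0

  locate : ℕ → ℕ × ℕ
  locate zero    = 0 , 0
  locate (suc p) = next (locate p)

  idx off : ℕ → ℕ
  idx p = proj₁ (locate p)
  off p = proj₂ (locate p)

  data Advance (p : ℕ) : Set where
    inside : suc (off p) < len (s (idx p)) → idx (suc p) ≡ idx p → off (suc p) ≡ suc (off p) → Advance p
    onto   : suc (off p) ≡ len (s (idx p)) → idx (suc p) ≡ suc (idx p) → off (suc p) ≡ 0 → Advance p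

  off<len : ∀ p → off p < len (s (idx p))
  off<len zero = len>0 (s 0)
  off<len (suc p) with suc (off p) <? len (s (idx p))
  ... | yes l< = l<
  ... | no  _  = len>0 (s (suc (idx p)))

  advance : ∀ p → Advance p
  advance p = go (suc (off p) <? len (s (idx p))) refl
    where
    go : (d : Dec (suc (off p) < len (s (idx p)))) → (suc (off p) <? len (s (idx p))) ≡ d → Advance p
    go (yes l<) e = inside l< (cong proj₁ next≡) (cong proj₂ next≡)
      where
      next≡ : next (locate p) ≡ (idx p , suc (off p))
      next≡ rewrite e = refl
    go (no ≮) e = onto (≤-antisym (off<len p) (≮⇒≥ ≮)) (cong proj₁ next≡) (cong proj₂ next≡)
      where
      next≡ : next (locate p) ≡ (suc (idx p) , 0)
      next≡ rewrite e = refl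

  located : ∀ p → p ≡ cut (idx p) + off p
  located zero = sym (trans (+-identityʳ _) cut-zero)
  located (suc p) with advance p
  ... | inside _ ei eo = trans (cong suc (located p)) (trans (sym (+-suc _ _)) (sym (cong₂ (λ i o → cut i + o) ei eo)))
  ... | onto len≡ ei eo = begin
    suc p                            ≡⟨ cong suc (located p) ⟩
    suc (cut (idx p) + off p)        ≡⟨ +-suc _ _ ⟨
    cut (idx p) + suc (off p)        ≡⟨ cong (cut (idx p) +_) len≡ ⟩
    cut (idx p) + len (s (idx p))    ≡⟨ cut-suc (idx p) ⟨
    cut (suc (idx p))                ≡⟨ +-identityʳ _ ⟨
    cut (suc (idx p)) + 0            ≡⟨ cong₂ (λ i o → cut i + o) ei eo ⟨
    cut (idx (suc p)) + off (suc p)  ∎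
    where open ≡-Reasoning

  ω≡ : ∀ p → ω p ≡ image (s (idx p)) (off p)
  ω≡ p = trans (cong ω (located p)) (letter-at (idx p) (off p) (off<len p))

  cut-< : ∀ i → cut i < cut (suc i)
  cut-< i = ≤-trans (m<m+n (cut i) (len>0 (s i))) (≤-reflexive (sym (cut-suc i)))

  cut-mono : ∀ {i j} → i ≤ j → cut i ≤ cut j
  cut-mono {i} {j} i≤j with m≤n⇒m<n∨m≡n i≤j
  ... | inj₂ refl = ≤-refl
  cut-mono {i} {suc j} i≤j | inj₁ i<j = ≤-trans (cut-mono (s≤s⁻¹ i<j)) (<⇒≤ (cut-< j))

  private
    not-before : ∀ {i j o r} → r < len (s j) → cut i + o ≡ cut j + r → ¬ i > j
    not-before {i} {j} {o} {r} r< e i>j = <⇒≱ (begin-strict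
      cut j + r              <⟨ +-monoʳ-< (cut j) r< ⟩
      cut j + len (s j)      ≡⟨ cut-suc j ⟨
      cut (suc j)            ≤⟨ cut-mono i>j ⟩
      cut i                  ≤⟨ m≤m+n (cut i) o ⟩
      cut i + o              ∎) (≤-reflexive e)
      where open ≤-Reasoning

  locate-unique : ∀ {p i o} → p ≡ cut i + o → o < len (s i) → idx p ≡ i × off p ≡ o
  locate-unique {p} {i} {o} e o< with <-cmp (idx p) i
  ... | tri> _ _ gt   = ⊥-elim (not-before o< (trans (sym (located p)) e) gt)
  ... | tri< l< _ _   = ⊥-elim (not-before (off<len p) (trans (sym e) (located p)) l<)
  ... | tri≈ _ refl _ = refl , +-cancelˡ-≡ (cut i) _ _ (trans (sym (located p)) e)

  idx-cut : ∀ i → idx (cut i) ≡ i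
  idx-cut i = proj₁ (locate-unique (sym (+-identityʳ (cut i))) (len>0 (s i)))

  off-cut : ∀ i → off (cut i) ≡ 0
  off-cut i = proj₂ (locate-unique (sym (+-identityʳ (cut i))) (len>0 (s i)))

  record SameState (p q : ℕ) : Set where
    constructor same-state
    field
      same-letter : s (idx p) ≡ s (idx q)
      same-offset : off p ≡ off q
  open SameState public

  SameState-sym : ∀ {p q} → SameState p q → SameState q p
  SameState-sym (same-state l o) = same-state (sym l) (sym o)

  SameState⇒≡ : ∀ {p q} → SameState p q → ω p ≡ ω q
  SameState⇒≡ {p} {q} S = trans (ω≡ p) (trans (cong₂ image (same-letter S) (same-offset S)) (sym (ω≡ q)))

  both-cuts : ∀ {p q} → off p ≡ 0 → off q ≡ 0 → ω p ≡ ω q → SameState p q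
  both-cuts {p} {q} op oq e = same-state
    (first-inj (trans (cong (image _) (sym op)) (trans (sym (ω≡ p)) (trans e (trans (ω≡ q) (cong (image _) oq))))))
    (trans op (sym oq))

  same-offset-next : ∀ {p q} → SameState p q → off (suc p) ≡ off (suc q)
  same-offset-next {p} {q} S with advance p | advance q
  ... | inside _ _ eo | inside _ _ eo′ = trans eo (trans (cong suc (same-offset S)) (sym eo′))
  ... | onto _ _ eo   | onto _ _ eo′   = trans eo (sym eo′)
  ... | inside l< _ _ | onto e _ _     = ⊥-elim (<⇒≢ l< (trans (cong suc (same-offset S)) (trans e (cong len (sym (same-letter S))))))
  ... | onto e _ _    | inside l< _ _  = ⊥-elim (<⇒≢ l< (trans (cong suc (sym (same-offset S))) (trans e (cong len (same-letter S)))))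

  -- Inside a block the state alone determines the next one; at a cut the next letter of ω is the
  -- first letter of a block and identifies it. The alternative hypothesis lets a parsing inside a
  -- block predict the next letter.
  forward : ∀ {p q} → SameState p q → ω (suc p) ≡ ω (suc q) ⊎ off (suc p) ≢ 0 → SameState (suc p) (suc q)
  forward {p} {q} S h with advance p | advance q | same-offset-next S
  ... | inside _ ei _ | inside _ ei′ _ | so = same-state (trans (cong s ei) (trans (same-letter S) (cong s (sym ei′)))) so
  ... | onto _ _ eo   | onto _ _ eo′   | so with h
  ...   | inj₁ e  = both-cuts eo eo′ e
  ...   | inj₂ ne = ⊥-elim (ne eo)
  forward S h | inside _ _ eo | onto _ _ eo′ | so = case trans (sym eo) (trans so eo′) of λ ()
  forward S h | onto _ _ eo | inside _ _ eo′ | so = case trans (sym eo) (trans so eo′) of λ ()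

  -- Stepping back over a cut, the letter read is the last one of a block and identifies it.
  backward : ∀ {p q} → SameState (suc p) (suc q) → ω p ≡ ω q → SameState p q
  backward {p} {q} S e with advance p | advance q
  ... | inside _ ei eo | inside _ ei′ eo′ = same-state
          (trans (cong s (sym ei)) (trans (same-letter S) (cong s ei′)))
          (suc-injective (trans (sym eo) (trans (same-offset S) eo′)))
  ... | inside _ _ eo | onto _ _ eo′ = case trans (sym eo) (trans (same-offset S) eo′) of λ ()
  ... | onto _ _ eo | inside _ _ eo′ = case trans (sym eo) (trans (same-offset S) eo′) of λ ()
  ... | onto el _ _ | onto el′ _ _ = same-state same
          (suc-injective (trans el (trans (cong len same) (sym el′))))
    where
    same : s (idx p) ≡ s (idx q)
    same = last-inj el el′ (trans (sym (ω≡ p)) (trans e (ω≡ q)))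

iterate-period : ∀ {ω V p d} → Agree ω V p (p + d) → ∀ q u n → u + q * d + n ≤ V + d → Agree ω n (p + u) (p + u + q * d)
iterate-period {ω} {V} {p} {d} A zero u n h = subst (Agree ω n (p + u)) (sym (+-identityʳ (p + u))) Agree-refl
iterate-period {ω} {V} {p} {d} A (suc q) u n h = Agree-trans
  (agree λ t t<n → Agree-at (u + t) A (bound t t<n (q * d) h) (+-assoc p u t) (regroup t))
  (subst (Agree ω n (p + (u + d))) (regroup′ (q * d)) (iterate-period A q (u + d) n (subst (λ x → x + n ≤ V + d) (sym (+-assoc u d (q * d))) h)))
  where
  regroup : ∀ t → p + (u + d) + t ≡ p + d + (u + t)
  regroup t = solve (p ∷ u ∷ d ∷ t ∷ [])
  regroup′ : ∀ x → p + (u + d) + x ≡ p + u + (d + x)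
  regroup′ x = solve (p ∷ u ∷ d ∷ x ∷ [])
  bound : ∀ t → t < n → ∀ x → u + (d + x) + n ≤ V + d → u + t < V
  bound t t<n x h = lin (t<n ⊕ h ⊕ z≤n {x}) (solve (t ∷ n ∷ u ∷ d ∷ x ∷ V ∷ []))

-- Synchronization of parsings

module Synchronization {s ω : Word} (I : MarkedImage s ω) (aperiodic-s : UniformlyAperiodic s) where

  open MarkedImage I
  open Image I

  H : ℕ
  H = len false + len true

  len≤H : ∀ c → len c ≤ H
  len≤H false = m≤m+n _ _
  len≤H true  = m≤n+m _ _

  cut-≤ : ∀ i n → cut (i + n) ≤ cut i + n * H
  cut-≤ i zero    = ≤-reflexive (trans (cong cut (+-identityʳ i)) (sym (+-identityʳ (cut i))))
  cut-≤ i (suc n) = begin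
    cut (i + suc n)               ≡⟨ cong cut (+-suc i n) ⟩
    cut (suc (i + n))             ≡⟨ cut-suc (i + n) ⟩
    cut (i + n) + len (s (i + n)) ≤⟨ +-mono-≤ (cut-≤ i n) (len≤H _) ⟩
    cut i + n * H + H             ≡⟨ +-assoc (cut i) (n * H) H ⟩
    cut i + (n * H + H)           ≡⟨ cong (cut i +_) (+-comm (n * H) H) ⟩
    cut i + suc n * H             ∎
    where open ≤-Reasoning

  image-agree : ∀ {n i j} → Agree s n i j →
    ∃ λ S → cut (i + n) ≡ cut i + S × cut (j + n) ≡ cut j + S × n ≤ S × Agree ω S (cut i) (cut j)
  image-agree {zero} {i} {j} A = 0 , at i , at j , z≤n , agree λ _ ()
    where
    at : ∀ i → cut (i + 0) ≡ cut i + 0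
    at i = trans (cong cut (+-identityʳ i)) (sym (+-identityʳ (cut i)))
  image-agree {suc n} {i} {j} A with image-agree (Agree-≤ (n≤1+n n) A)
  ... | S , ei , ej , n≤S , B = S + len (s (i + n)) , at i ei refl , at j ej (sym same) ,
        ≤-trans (≤-reflexive (+-comm 1 n)) (+-mono-≤ n≤S (len>0 (s (i + n)))) ,
        Agree-append B (agree block)
    where
    same : s (i + n) ≡ s (j + n)
    same = letter A n ≤-refl
    at : ∀ k → cut (k + n) ≡ cut k + S → s (k + n) ≡ s (i + n) → cut (k + suc n) ≡ cut k + (S + len (s (i + n)))
    at k e c = trans (cong cut (+-suc k n)) (trans (cut-suc (k + n)) (trans (cong₂ _+_ e (cong len c)) (+-assoc (cut k) S _)))
    block : ∀ o → o < len (s (i + n)) → ω (cut i + S + o) ≡ ω (cut j + S + o)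
    block o o< = begin
      ω (cut i + S + o)     ≡⟨ cong (λ x → ω (x + o)) ei ⟨
      ω (cut (i + n) + o)   ≡⟨ letter-at (i + n) o o< ⟩
      image (s (i + n)) o   ≡⟨ cong (λ c → image c o) same ⟩
      image (s (j + n)) o   ≡⟨ letter-at (j + n) o (subst (λ c → o < len c) same o<) ⟨
      ω (cut (j + n) + o)   ≡⟨ cong (λ x → ω (x + o)) ej ⟩
      ω (cut j + S + o)     ∎
      where open ≡-Reasoning

  keep : ∀ {M p q} → SameState p q → Agree ω M p q → ∀ l → l < M → SameState (p + l) (q + l)
  keep {M} {p} {q} S A zero l<M = subst₂ SameState (sym (+-identityʳ p)) (sym (+-identityʳ q)) S
  keep {M} {p} {q} S A (suc l) l<M = subst₂ SameState (sym (+-suc p l)) (sym (+-suc q l))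
    (forward (keep S A l (<-trans (n<1+n l) l<M)) (inj₁ (Agree-at (suc l) A l<M (sym (+-suc p l)) (sym (+-suc q l)))))

  together : ∀ {p q} M → (∀ l → l < M → SameState (p + l) (q + l)) →
    ∃ λ K → idx (p + M) ≡ idx p + K × idx (q + M) ≡ idx q + K × Agree s K (idx p) (idx q)
  together {p} {q} zero S = 0 , at p , at q , agree λ _ ()
    where
    at : ∀ p → idx (p + 0) ≡ idx p + 0
    at p = trans (cong idx (+-identityʳ p)) (sym (+-identityʳ _))
  together {p} {q} (suc M) S with together M (λ l l<M → S l (m<n⇒m<1+n l<M))
  ... | K , ep , eq , A with S M ≤-refl | advance (p + M) | advance (q + M)
  ...   | SM | inside _ ei _ | inside _ ei′ _ = K , trans (cong idx (+-suc p M)) (trans ei ep) , trans (cong idx (+-suc q M)) (trans ei′ eq) , A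
  ...   | SM | onto _ ei _   | onto _ ei′ _   = suc K , at p ei ep , at q ei′ eq ,
            Agree-snoc A (trans (cong s (sym ep)) (trans (same-letter SM) (cong s eq)))
    where
    at : ∀ p → idx (suc (p + M)) ≡ suc (idx (p + M)) → idx (p + M) ≡ idx p + K → idx (p + suc M) ≡ idx p + suc K
    at p e e′ = trans (cong idx (+-suc p M)) (trans e (trans (cong suc e′) (sym (+-suc _ K))))
  ...   | SM | inside _ _ eo | onto _ _ eo′   = case trans (sym eo) (trans (same-offset-next SM) eo′) of λ ()
  ...   | SM | onto _ _ eo   | inside _ _ eo′ = case trans (sym eo) (trans (same-offset-next SM) eo′) of λ ()

  idx-step : ∀ p → idx p ≤ idx (suc p)
  idx-step p with advance p
  ... | inside _ e _ = ≤-reflexive (sym e)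
  ... | onto _ e _   = ≤-trans (n≤1+n _) (≤-reflexive (sym e))

  idx-mono : ∀ p k → idx p ≤ idx (p + k)
  idx-mono p zero    = ≤-reflexive (cong idx (sym (+-identityʳ p)))
  idx-mono p (suc k) = ≤-trans (idx-mono p k) (≤-trans (idx-step (p + k)) (≤-reflexive (cong idx (sym (+-suc p k)))))

  -- From two cuts, equal letters give equal blocks one after the other, and n blocks take at most
  -- `n * H` letters. The additional letter provides the first comparison even for n = 0.
  parse : ∀ n {i j} → Agree ω (suc (n * H)) (cut i) (cut j) → Agree s n i j
  parse n {i} {j} A with together (n * H)
      (λ l l< → keep (both-cuts (off-cut i) (off-cut j) (Agree-head A)) A l (m<n⇒m<1+n l<))
  ... | K , ei , _ , B = Agree-≤ n≤K (subst₂ (Agree s K) (idx-cut i) (idx-cut j) B)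
    where
    n≤K : n ≤ K
    n≤K with m≤n⇒∃[o]m+o≡n (cut-≤ i n)
    ... | r , e = +-cancelˡ-≤ i n K (begin
      i + n                      ≡⟨ idx-cut (i + n) ⟨
      idx (cut (i + n))          ≤⟨ idx-mono (cut (i + n)) r ⟩
      idx (cut (i + n) + r)      ≡⟨ cong idx e ⟩
      idx (cut i + n * H)        ≡⟨ ei ⟩
      idx (cut i) + K            ≡⟨ cong (_+ K) (idx-cut i) ⟩
      i + K                      ∎)
      where open ≤-Reasoning

  after-cut : ∀ p → p ≤ cut (suc (idx p))
  after-cut p = begin
    p                              ≡⟨ located p ⟩
    cut (idx p) + off p            ≤⟨ +-monoʳ-≤ (cut (idx p)) (<⇒≤ (off<len p)) ⟩
    cut (idx p) + len (s (idx p))  ≡⟨ cut-suc (idx p) ⟨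
    cut (suc (idx p))              ∎
    where open ≤-Reasoning

  cut-idx≤ : ∀ p → cut (idx p) ≤ p
  cut-idx≤ p = ≤-trans (m≤m+n _ (off p)) (≤-reflexive (sym (located p)))

  opaque
    -- Among d + 1 consecutive cuts in a long run of period d, two are congruent modulo d. The run
    -- reads alike from both, so `parse` would give s a run with a period at most D. The first
    -- summand of `V` reaches the cuts, the second feeds `parse`.
    aperiodic-ω : UniformlyAperiodic ω
    aperiodic-ω = record { modulus = V ; not-agree = λ {D} {d} {p} → not-agree-ω D d p }
      where
      open UniformlyAperiodic aperiodic-s
      V : ℕ → ℕ
      V D = suc D * H + suc (modulus D * H)
      not-agree-ω : ∀ D d p → 0 < d → d ≤ D → ¬ Agree ω (V D) p (p + d)
      not-agree-ω D d p 0<d d≤D A with pigeonhole-% d {{>-nonZero 0<d}} (λ x → cut (suc (idx p) + x))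
                                         (λ x → <-≤-trans (cut-< (suc (idx p) + x)) (≤-reflexive (cong cut (sym (+-suc (suc (idx p)) x)))))
      ... | m , n , m<n , n≤d , q , e with m≤n⇒∃[o]m+o≡n m<n | m≤n⇒∃[o]m+o≡n (≤-trans (after-cut p) (cut-mono (m≤m+n (suc (idx p)) m)))
      ...   | r , er | u , eu = not-agree {D} {suc r} {suc (idx p) + m} z<s
                (≤-trans (s≤s (m≤n+m r m)) (≤-trans (≤-reflexive er) (≤-trans n≤d d≤D)))
                (parse (modulus D) (subst₂ (Agree ω (suc (modulus D * H))) eu end
                  (iterate-period A (suc q) u (suc (modulus D * H)) (fits (suc q * d) (suc D * H) near))))
        where
        end : p + u + suc q * d ≡ cut (suc (idx p) + m + suc r)
        end = trans (cong (_+ suc q * d) eu) (trans (sym e) (cong cut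
          (trans (cong (suc (idx p) +_) (trans (sym er) (sym (+-suc m r)))) (sym (+-assoc (suc (idx p)) m (suc r))))))
        near : p + u + suc q * d ≤ p + suc D * H
        near = begin
          p + u + suc q * d           ≡⟨ trans (cong (_+ suc q * d) eu) (sym e) ⟩
          cut (suc (idx p) + n)       ≡⟨ cong cut (sym (+-suc (idx p) n)) ⟩
          cut (idx p + suc n)         ≤⟨ cut-≤ (idx p) (suc n) ⟩
          cut (idx p) + suc n * H     ≤⟨ +-mono-≤ (cut-idx≤ p) (*-monoˡ-≤ H (s≤s (≤-trans n≤d d≤D))) ⟩
          p + suc D * H               ∎
          where open ≤-Reasoning
        fits : ∀ x y → p + u + x ≤ p + y → u + x + suc (modulus D * H) ≤ y + suc (modulus D * H) + d
        fits x y h = ≤-trans (+-monoˡ-≤ (suc (modulus D * H)) (+-cancelˡ-≤ p _ _ (≤-trans (≤-reflexive (sym (+-assoc p u x))) h)))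
                             (m≤m+n _ d)

  letter-code : Bool → Fin 2
  letter-code false = fzero
  letter-code true  = fsuc fzero

  letter-code-inj : ∀ {b c} → letter-code b ≡ letter-code c → b ≡ c
  letter-code-inj {false} {false} _ = refl
  letter-code-inj {true}  {true}  _ = refl

  state-code : ℕ → Fin (2 * H)
  state-code p = combine (letter-code (s (idx p))) (fromℕ< (<-≤-trans (off<len p) (len≤H (s (idx p)))))

  state-code-inj : ∀ {p q} → state-code p ≡ state-code q → SameState p q
  state-code-inj e with Fin.combine-injective _ _ _ _ e
  ... | el , eo = same-state (letter-code-inj el) (Fin.fromℕ<-injective _ _ _ _ eo)

  -- A parsing that is inside a block knows the next letter; as both parsings read the same word,
  -- this letter tells the other one which block begins.
  pair-step : ∀ {x x′ y y′} → SameState x x′ → SameState y y′ → ω (suc x) ≡ ω (suc y) → ω (suc x′) ≡ ω (suc y′) →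
    ¬ (off (suc x) ≡ 0 × off (suc y) ≡ 0) → SameState (suc x) (suc x′) × SameState (suc y) (suc y′)
  pair-step {x} {x′} {y} {y′} Sx Sy e e′ ne with off (suc y) ≟ 0
  ... | no y≢0 = forward Sx (inj₁ (trans e (trans (SameState⇒≡ Sy′) (sym e′)))) , Sy′
    where
    Sy′ : SameState (suc y) (suc y′)
    Sy′ = forward Sy (inj₂ y≢0)
  ... | yes y≡0 = Sx′ , forward Sy (inj₁ (trans (sym e) (trans (SameState⇒≡ Sx′) e′)))
    where
    Sx′ : SameState (suc x) (suc x′)
    Sx′ = forward Sx (inj₂ λ x≡0 → ne (x≡0 , y≡0))

  rewind : ∀ {p q} t → Agree ω t p q → SameState (p + t) (q + t) → SameState p q
  rewind {p} {q} zero A S = subst₂ SameState (+-identityʳ p) (+-identityʳ q) S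
  rewind {p} {q} (suc t) A S = rewind t (Agree-≤ (n≤1+n t) A)
    (backward (subst₂ SameState (+-suc p t) (+-suc q t) S) (letter A t ≤-refl))

  -- Two parsings of the same word without a common cut determine each other, so the pair of
  -- states evolves deterministically and the word becomes periodic.
  opaque
    synchronization : ∃ λ L → ∀ {p q} → Agree ω L p q → SameState p q
    synchronization = L , sync
      where
      open UniformlyAperiodic aperiodic-ω
      C V L : ℕ
      -- `C` bounds the number of pairs of states, so a pair repeats at a distance of at most `C`; a
      -- run of length `V` with such a period is impossible.
      C = 2 * H * (2 * H)
      V = modulus C
      L = suc (C + V)
      sync : ∀ {p q} → Agree ω L p q → SameState p q
      sync {p} {q} A with find< (λ t → (off (p + t) ≟ 0) ×-dec (off (q + t) ≟ 0)) L
      ... | inj₁ (t , t<L , op , oq) = rewind t (Agree-≤ (<⇒≤ t<L) A) (both-cuts op oq (letter A t t<L))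
      ... | inj₂ none with Fin.pigeonhole ≤-refl (λ (t : Fin (suc C)) → combine (state-code (p + toℕ t)) (state-code (q + toℕ t)))
      ...   | a , b , a<b , e with Fin.combine-injective _ _ _ _ e | m≤n⇒∃[o]m+o≡n a<b
      ...     | ep , eq | r , er = ⊥-elim (not-agree {C} {suc r} {p + toℕ a} z<s
                  (≤-trans (s≤s (m≤n+m r (toℕ a))) (≤-trans (≤-reflexive er) b≤C))
                  (subst (Agree ω V (p + toℕ a)) (trans (cong (p +_) (trans (sym er) (sym (+-suc (toℕ a) r)))) (sym (+-assoc p (toℕ a) (suc r))))
                    (agree λ l l<V → SameState⇒≡ (proj₁ (run l l<V)))))
        where
        b≤C : toℕ b ≤ C
        b≤C = s≤s⁻¹ (Fin.toℕ<n b)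
        run : ∀ l → l < V → SameState (p + toℕ a + l) (p + toℕ b + l) × SameState (q + toℕ a + l) (q + toℕ b + l)
        run zero l<V = subst₂ SameState (sym (+-identityʳ _)) (sym (+-identityʳ _)) (state-code-inj ep) ,
                       subst₂ SameState (sym (+-identityʳ _)) (sym (+-identityʳ _)) (state-code-inj eq)
        run (suc l) l<V = let Sp , Sq = run l (<-trans (n<1+n l) l<V)
                              Sp′ , Sq′ = pair-step Sp Sq (at a) (at b) not-both
                          in subst₂ SameState (sym (+-suc _ l)) (sym (+-suc _ l)) Sp′ ,
                             subst₂ SameState (sym (+-suc _ l)) (sym (+-suc _ l)) Sq′
          where
          next≡ : ∀ p (t : Fin (suc C)) → suc (p + toℕ t + l) ≡ p + (toℕ t + suc l)
          next≡ p t = trans (sym (+-suc (p + toℕ t) l)) (+-assoc p (toℕ t) (suc l))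
          in-range : ∀ (t : Fin (suc C)) → toℕ t + suc l < L
          in-range t = s≤s (+-mono-≤ (s≤s⁻¹ (Fin.toℕ<n t)) (<⇒≤ l<V))
          at : ∀ (t : Fin (suc C)) → ω (suc (p + toℕ t + l)) ≡ ω (suc (q + toℕ t + l))
          at t = Agree-at (toℕ t + suc l) A (in-range t) (next≡ p t) (next≡ q t)
          not-both : ¬ (off (suc (p + toℕ a + l)) ≡ 0 × off (suc (q + toℕ a + l)) ≡ 0)
          not-both (x , y) = none (toℕ a + suc l) (in-range a) (trans (cong off (sym (next≡ p a))) x , trans (cong off (sym (next≡ q a))) y)

-- Right special factors and order of suffixes of the image

module Branching {s ω : Word} (sturmian : Sturmian s) (I : MarkedImage s ω) where

  open Sturmian-word s sturmian
  open Recurrence s sturmian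
  open MarkedImage I
  open Image I
  open Synchronization I uniformly-aperiodic

  L : ℕ
  L = proj₁ synchronization

  sync : ∀ {p q} → Agree ω L p q → SameState p q
  sync = proj₂ synchronization

  record Branch (M p q : ℕ) : Set where
    field
      states  : ∀ l → l < M → SameState (p + l) (q + l)
      cut-p   : off (p + M) ≡ 0
      cut-q   : off (q + M) ≡ 0
      blocks  : ℕ
      idx-p   : idx (p + M) ≡ idx p + blocks
      idx-q   : idx (q + M) ≡ idx q + blocks
      exact-s : Exact s blocks (idx p) (idx q)

  -- Equal states inside a block give equal letters, so the mismatch must fall on a cut, where it is
  -- a mismatch between letters of s.
  branch : ∀ {M p q} → SameState p q → Exact ω M p q → Branch M p q
  branch {zero} {p} {q} S E = ⊥-elim (differ E
    (trans (cong ω (+-identityʳ p)) (trans (SameState⇒≡ S) (cong ω (sym (+-identityʳ q))))))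
  branch {suc M} {p} {q} S E = record
    { states = st ; cut-p = cp ; cut-q = cq ; blocks = K ; idx-p = ep ; idx-q = eq
    ; exact-s = exact A λ e → differ E (SameState⇒≡ (same-state
        (trans (cong s ep) (trans e (cong s (sym eq)))) (trans cp (sym cq)))) }
    where
    st : ∀ l → l < suc M → SameState (p + l) (q + l)
    st = keep S (agreement E)
    t = together (suc M) st
    K = proj₁ t
    ep : idx (p + suc M) ≡ idx p + K
    ep = proj₁ (proj₂ t)
    eq : idx (q + suc M) ≡ idx q + K
    eq = proj₁ (proj₂ (proj₂ t))
    A : Agree s K (idx p) (idx q)
    A = proj₂ (proj₂ (proj₂ t))
    cp : off (p + suc M) ≡ 0
    cp with off (p + suc M) ≟ 0
    ... | yes e = e
    ... | no ne = ⊥-elim (differ E (subst₂ (λ x y → ω x ≡ ω y) (sym (+-suc p M)) (sym (+-suc q M))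
            (SameState⇒≡ (forward (st M ≤-refl) (inj₂ λ e → ne (trans (cong off (+-suc p M)) e))))))
    cq : off (q + suc M) ≡ 0
    cq = trans (cong off (+-suc q M)) (trans (sym (same-offset-next (st M ≤-refl))) (trans (cong off (sym (+-suc p M))) cp))

  open Branch

  branch-cut : ∀ {p i} → off p ≡ 0 → idx p ≡ i → p ≡ cut i
  branch-cut {p} o≡0 refl = trans (located p) (trans (cong (cut (idx p) +_) o≡0) (+-identityʳ _))

  -- The right special factor of s under `B` is a suffix of the one under `C`, by uniqueness in s,
  -- so the images agree. Both end at the cut of the branching, and `p` and `q` lie M letters before
  -- it.
  branches-agree : ∀ {M p p′ q q′ e} (B : Branch M p p′) (C : Branch M q q′) → e + blocks B ≡ blocks C → Agree ω M p q
  branches-agree {M} {p} {p′} {q} {q′} {e} B C eq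
    with S , ei , ej , _ , A ← image-agree (right-special-unique (exact-s B) (Exact-shift e (subst (λ K → Exact s K (idx q) (idx q′)) (sym eq) (exact-s C))))
    = subst₂ (Agree ω M) (sym (located p)) (sym q≡) (Agree-shift (off p) (subst (λ S → Agree ω S (cut (idx p)) (cut (idx q + e))) S≡ A))
    where
    S≡ : S ≡ off p + M
    S≡ = +-cancelˡ-≡ (cut (idx p)) _ _ (begin
      cut (idx p) + S               ≡⟨ ei ⟨
      cut (idx p + blocks B)        ≡⟨ branch-cut (cut-p B) (idx-p B) ⟨
      p + M                         ≡⟨ cong (_+ M) (located p) ⟩
      cut (idx p) + off p + M       ≡⟨ +-assoc (cut (idx p)) (off p) M ⟩
      cut (idx p) + (off p + M)     ∎)
      where open ≡-Reasoning
    q≡ : q ≡ cut (idx q + e) + off p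
    q≡ = +-cancelʳ-≡ M _ _ (begin
      q + M                             ≡⟨ branch-cut (cut-p C) (idx-p C) ⟩
      cut (idx q + blocks C)            ≡⟨ cong (λ K → cut (idx q + K)) eq ⟨
      cut (idx q + (e + blocks B))      ≡⟨ cong cut (+-assoc (idx q) e (blocks B)) ⟨
      cut (idx q + e + blocks B)        ≡⟨ ej ⟩
      cut (idx q + e) + S               ≡⟨ cong (cut (idx q + e) +_) S≡ ⟩
      cut (idx q + e) + (off p + M)     ≡⟨ +-assoc (cut (idx q + e)) (off p) M ⟨
      cut (idx q + e) + off p + M       ∎)
      where open ≡-Reasoning

  right-special-unique-ω : ∀ {M p p′ q q′} → L ≤ M → Exact ω M p p′ → Exact ω M q q′ → Agree ω M p q
  right-special-unique-ω {M} {p} {p′} {q} {q′} L≤M E F = go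
    (branch (sync (Agree-≤ L≤M (agreement E))) E) (branch (sync (Agree-≤ L≤M (agreement F))) F)
    where
    go : Branch M p p′ → Branch M q q′ → Agree ω M p q
    go B C with ≤-total (blocks B) (blocks C)
    ... | inj₁ le = branches-agree {e = blocks C ∸ blocks B} B C (m∸n+n≡m le)
    ... | inj₂ ge = Agree-sym (branches-agree {e = blocks B ∸ blocks C} C B (m∸n+n≡m ge))

  opaque
    -- The image of a right special factor of s of length M has at least M letters, and its two
    -- continuations begin with different letters; its suffix of length M serves.
    right-special-exists-ω : ∀ M → ∃₂ λ p q → Exact ω M p q
    right-special-exists-ω M
      with i , j , E ← right-special-exists M
      with S , ei , ej , M≤S , A ← image-agree (agreement E)
      with d , refl ← m≤n⇒∃[o]m+o≡n M≤S
      = cut i + d , cut j + d , Exact-shift d (subst (λ S → Exact ω S (cut i) (cut j)) (+-comm M d) (exact A λ e →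
          differ E (first-inj (trans (sym (at i ei)) (trans e (at j ej))))))
      where
      at : ∀ k → cut (k + M) ≡ cut k + (M + d) → ω (cut k + (M + d)) ≡ image (s (k + M)) 0
      at k ek = trans (cong ω (trans (sym ek) (sym (+-identityʳ _)))) (letter-at (k + M) 0 (len>0 _))

  opaque
    -- The block containing `x` and the n blocks after it recur in s. Each of those n blocks gives
    -- at least one letter, so the image covers n letters from `x`.
    recurrent-ω : ∀ n → ∃ λ W → ∀ x p → ∃ λ k → k < W × Agree ω n x (p + k)
    recurrent-ω n = suc ((suc (proj₁ (recurrent (suc n)))) * H + H) , find
      where
      W : ℕ
      W = proj₁ (recurrent (suc n))
      find : ∀ x p → ∃ λ k → k < suc (suc W * H + H) × Agree ω n x (p + k)
      find x p
        with k , k<W , A ← proj₂ (recurrent (suc n)) (idx x) (suc (idx p))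
        with S , ei , ej , _ , B ← image-agree A
        with u , eu ← m≤n⇒∃[o]m+o≡n (≤-trans (after-cut p) (cut-mono (m≤m+n (suc (idx p)) k)))
        = u + off x , s≤s (+-mono-≤ near (≤-trans (<⇒≤ (off<len x)) (len≤H _))) ,
          subst₂ (Agree ω n) (sym (located x)) (trans (cong (_+ off x) (sym eu)) (+-assoc p u (off x)))
            (Agree-shift (off x) (Agree-≤ long B))
        where
        near : u ≤ suc W * H
        near = +-cancelˡ-≤ p _ _ (begin
          p + u                        ≡⟨ eu ⟩
          cut (suc (idx p) + k)        ≡⟨ cong cut (sym (+-suc (idx p) k)) ⟩
          cut (idx p + suc k)          ≤⟨ cut-≤ (idx p) (suc k) ⟩
          cut (idx p) + suc k * H      ≤⟨ +-mono-≤ (cut-idx≤ p) (*-monoˡ-≤ H (s≤s (<⇒≤ k<W))) ⟩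
          p + suc W * H                ∎)
          where open ≤-Reasoning
        long : off x + n ≤ S
        long with S′ , e′ , _ , n≤S′ , _ ← image-agree {n} {suc (idx x)} Agree-refl = +-cancelˡ-≤ (cut (idx x)) _ _ (begin
          cut (idx x) + (off x + n)             ≤⟨ +-monoʳ-≤ (cut (idx x)) (+-mono-≤ (<⇒≤ (off<len x)) n≤S′) ⟩
          cut (idx x) + (len (s (idx x)) + S′)  ≡⟨ +-assoc (cut (idx x)) _ S′ ⟨
          cut (idx x) + len (s (idx x)) + S′    ≡⟨ cong (_+ S′) (cut-suc (idx x)) ⟨
          cut (suc (idx x)) + S′                ≡⟨ e′ ⟨
          cut (suc (idx x) + n)                 ≡⟨ cong cut (sym (+-suc (idx x) n)) ⟩
          cut (idx x + suc n)                   ≡⟨ ei ⟩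
          cut (idx x) + S                       ∎)
          where open ≤-Reasoning

  -- The order that the first letters of the images induce on suffixes of s: the
  -- lexicographic one or its reverse.
  record Oriented (i j : ℕ) : Set where
    constructor oriented
    field
      {at}   : ℕ
      shared : Agree s at i j
      below  : image (s (i + at)) 0 ≡ false
      above  : image (s (j + at)) 0 ≡ true

  orientation : (∀ c → image c 0 ≡ c) ⊎ (∀ c → image c 0 ≡ not c)
  orientation with image false 0 in e₀ | image true 0 in e₁
  ... | false | true  = inj₁ λ { false → e₀ ; true → e₁ }
  ... | true  | false = inj₂ λ { false → e₀ ; true → e₁ }
  ... | false | false = case first-inj (trans e₀ (sym e₁)) of λ ()
  ... | true  | true  = case first-inj (trans e₀ (sym e₁)) of λ ()

  not-swapped : ∀ {x} {b} → image x 0 ≡ b → image x 0 ≡ not x → x ≡ not b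
  not-swapped {false} {b} e e′ with refl ← trans (sym e′) e = refl
  not-swapped {true}  {b} e e′ with refl ← trans (sym e′) e = refl

  -- If T exchanges the first letters, `Oriented` is the reversed order, and `no-swap` applies with
  -- `x` and `y` in exchanged roles.
  no-swap-oriented : ∀ {x y d} → wt s x d ≡ wt s y d → Oriented x (x + d) → Oriented (y + d) y → ⊥
  no-swap-oriented e (oriented A lo hi) (oriented A′ lo′ hi′) with orientation
  ... | inj₁ same = no-swap e (lt A (trans (sym (same _)) lo) (trans (sym (same _)) hi))
                              (lt A′ (trans (sym (same _)) lo′) (trans (sym (same _)) hi′))
  ... | inj₂ flip = no-swap (sym e) (lt (Agree-sym A′) (not-swapped hi′ (flip _)) (not-swapped lo′ (flip _)))
                                    (lt (Agree-sym A) (not-swapped hi (flip _)) (not-swapped lo (flip _)))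

  -- At a cut this is weaker than `SameState`: the blocks that begin there may differ. This is
  -- needed when the later of the compared positions is the fork itself.
  record Aligned (x y : ℕ) : Set where
    constructor aligned
    field
      offsets : off x ≡ off y
      letters : off x ≡ 0 ⊎ s (idx x) ≡ s (idx y)
  open Aligned

  SameState⇒Aligned : ∀ {x y} → SameState x y → Aligned x y
  SameState⇒Aligned S = aligned (same-offset S) (inj₂ (same-letter S))

  -- Either the first letters agree, and `branch` places the mismatch at a later cut, or they
  -- differ, which aligned positions allow only at a cut.
  Lt⇒Oriented : ∀ {x y} → Aligned x y → Lt ω x y → Oriented (idx x) (idx y)
  Lt⇒Oriented {x} {y} Al ord with ω x Bool.≟ ω y
  Lt⇒Oriented {x} {y} Al ord | yes e = oriented (agreement (exact-s B))
      (at x (cut-p B) (idx-p B) (low ord)) (at y (cut-q B) (idx-q B) (high ord))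
    where
    state : off x ≡ 0 ⊎ s (idx x) ≡ s (idx y) → SameState x y
    state (inj₁ o≡0) = both-cuts o≡0 (trans (sym (offsets Al)) o≡0) e
    state (inj₂ l≡)  = same-state l≡ (offsets Al)
    B = branch (state (letters Al)) (Lt⇒Exact ord)
    at : ∀ x {b} → off (x + position ord) ≡ 0 → idx (x + position ord) ≡ idx x + blocks B → ω (x + position ord) ≡ b →
         image (s (idx x + blocks B)) 0 ≡ b
    at x o≡ i≡ e = trans (sym (cong₂ (λ i o → image (s i) o) i≡ o≡)) (trans (sym (ω≡ _)) e)
  Lt⇒Oriented {x} {y} Al (lt {suc m} A lo hi) | no ne = ⊥-elim (ne (Agree-head A))
  Lt⇒Oriented {x} {y} Al (lt {zero} A lo hi) | no ne with letters Al
  ... | inj₂ l≡  = ⊥-elim (ne (SameState⇒≡ (same-state l≡ (offsets Al))))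
  ... | inj₁ o≡0 = oriented {at = 0} (agree λ _ ()) (at x o≡0 lo) (at y (trans (sym (offsets Al)) o≡0) hi)
    where
    at : ∀ x {b} → off x ≡ 0 → ω (x + 0) ≡ b → image (s (idx x + 0)) 0 ≡ b
    at x o≡ e = trans (sym (cong₂ (λ i o → image (s i) o) (sym (+-identityʳ (idx x))) o≡))
                      (trans (sym (ω≡ x)) (trans (cong ω (sym (+-identityʳ x))) e))

  Branch-sym : ∀ {M p q} → Branch M p q → Branch M q p
  Branch-sym B = record
    { states = λ l l<M → SameState-sym (states B l l<M) ; cut-p = cut-q B ; cut-q = cut-p B ; blocks = blocks B
    ; idx-p = idx-q B ; idx-q = idx-p B ; exact-s = Exact-sym (exact-s B) }

  Aligned-sym : ∀ {x y} → Aligned x y → Aligned y x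
  Aligned-sym (aligned o (inj₁ o≡0)) = aligned (sym o) (inj₁ (trans (sym o) o≡0))
  Aligned-sym (aligned o (inj₂ l≡))  = aligned (sym o) (inj₂ (sym l≡))

  Aligned-transfer : ∀ {M p q k m} → Branch M p q → k < m → m ≤ M → Aligned (p + k) (p + m) → Aligned (q + k) (q + m)
  Aligned-transfer {M} {p} {q} {k} {m} B k<m m≤M Al with m≤n⇒m<n∨m≡n m≤M | states B k (<-≤-trans k<m m≤M)
  ... | inj₁ m<M | Sk with states B m m<M | letters Al
  ...   | Sm | inj₁ o≡0 = aligned (trans (sym (same-offset Sk)) (trans (offsets Al) (same-offset Sm)))
                            (inj₁ (trans (sym (same-offset Sk)) o≡0))
  ...   | Sm | inj₂ l≡  = aligned (trans (sym (same-offset Sk)) (trans (offsets Al) (same-offset Sm)))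
                            (inj₂ (trans (sym (same-letter Sk)) (trans l≡ (same-letter Sm))))
  Aligned-transfer {M} {p} {q} {k} {m} B k<m m≤M Al | inj₂ refl | Sk = aligned (trans k≡0 (sym (cut-q B))) (inj₁ k≡0)
    where
    k≡0 : off (q + k) ≡ 0
    k≡0 = trans (sym (same-offset Sk)) (trans (offsets Al) (cut-p B))

  -- Both windows of ω parse alike, so the windows of s between the two compared blocks coincide and
  -- have equal weight. A reversal would contradict `no-swap-oriented`.
  aligned-order-preserved : ∀ {M p q k m} → Branch M p q → k < m → m ≤ M → Aligned (p + k) (p + m) →
    Lt ω (p + k) (p + m) → Lt ω (q + m) (q + k) → ⊥
  aligned-order-preserved {M} {p} {q} {k} {m} B k<m m≤M Al ord ord′
    with Kk , pk , qk , _ ← together {p} {q} k (λ l l<k → states B l (<-trans l<k (<-≤-trans k<m m≤M)))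
    with Km , pm , qm , A ← together {p} {q} m (λ l l<m → states B l (<-≤-trans l<m m≤M))
    with Al′ ← Aligned-transfer B k<m m≤M Al
    with r , refl ← m≤n⇒∃[o]m+o≡n (<⇒≤ k<m)
    with d , refl ← m≤n⇒∃[o]m+o≡n (+-cancelˡ-≤ (idx p) Kk Km (subst₂ _≤_ pk
                      (trans (cong idx (+-assoc p k r)) pm) (idx-mono (p + k) r)))
    = no-swap-oriented
        (wt-agree (Agree-shift Kk A))
        (subst₂ Oriented pk (trans pm (sym (+-assoc (idx p) Kk d))) (Lt⇒Oriented Al ord))
        (subst₂ Oriented (trans qm (sym (+-assoc (idx q) Kk d))) qk (Lt⇒Oriented (Aligned-sym Al′) ord′))

  long-order-preserved : ∀ {M p q k m} → L ≤ M → Exact ω M p q → k < m → m ≤ M →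
    Agree ω L (p + k) (p + m) ⊎ Agree ω L (q + k) (q + m) →
    Lt ω (p + k) (p + m) → Lt ω (q + m) (q + k) → ⊥
  long-order-preserved {M} {p} {q} {k} {m} L≤M E k<m m≤M A =
    aligned-order-preserved B k<m m≤M (Al A)
    where
    B : Branch M p q
    B = branch (sync (Agree-≤ L≤M (agreement E))) E
    Al : Agree ω L (p + k) (p + m) ⊎ Agree ω L (q + k) (q + m) → Aligned (p + k) (p + m)
    Al (inj₁ A) = SameState⇒Aligned (sync A)
    Al (inj₂ A) = Aligned-transfer (Branch-sym B) k<m m≤M (SameState⇒Aligned (sync A))

-- Subpermutations versus factors

module Comparison {s ω : Word} (sturmian : Sturmian s) (I : MarkedImage s ω) where

  open Branching sturmian I
  open Recurrence s sturmian using (uniformly-aperiodic)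
  open Synchronization I uniformly-aperiodic using (aperiodic-ω)
  open UniformlyAperiodic aperiodic-ω

  opaque
    mismatch-< : ∀ {p q} → p < q → ∃ λ M → Exact ω M p q
    mismatch-< {p} p<q with m≤n⇒∃[o]m+o≡n p<q
    ... | d , refl with first-mismatch {ω} (modulus (suc d)) p (p + suc d)
    ...   | inj₁ (M , _ , E) = M , subst (Exact ω M p) (+-suc p d) E
    ...   | inj₂ A = ⊥-elim (not-agree z<s ≤-refl A)

  mismatch : ∀ {p q} → p ≢ q → ∃ λ M → Exact ω M p q
  mismatch {p} {q} p≢q with <-cmp p q
  ... | tri≈ _ p≡q _ = ⊥-elim (p≢q p≡q)
  ... | tri< p<q _ _ = mismatch-< p<q
  ... | tri> _ _ q<p = let M , E = mismatch-< q<p in M , Exact-sym E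

  Lt-total : ∀ {p q} → p ≢ q → Lt ω p q ⊎ Lt ω q p
  Lt-total p≢q = Exact⇒Lt (proj₂ (mismatch p≢q))

  record Fork (M p q : ℕ) : Set where
    constructor fork
    field
      prong   : Exact ω M p q
      to-zero : ω (p + M) ≡ false
      to-one  : ω (q + M) ≡ true
  open Fork

  Exact⇒Fork : ∀ {M p q} → Exact ω M p q → Fork M p q ⊎ Fork M q p
  Exact⇒Fork {M} {p} {q} E with ω (p + M) in e | ω (q + M) in e′
  ... | false | false = ⊥-elim (differ E (trans e (sym e′)))
  ... | false | true  = inj₁ (fork E e e′)
  ... | true  | false = inj₂ (fork (Exact-sym E) e′ e)
  ... | true  | true  = ⊥-elim (differ E (trans e (sym e′)))

  -- `L` letters make the right special factor unique; the further `modulus L` exclude periods up to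
  -- `L` in it.
  M₀ : ℕ
  M₀ = L + modulus L

  -- A second branching within L letters would make a right special word of length M₀ have a period at most L.
  same-future : ∀ {x x′ y y′} → Exact ω M₀ x x′ → Exact ω M₀ y y′ → ω (x + M₀) ≡ ω (y + M₀) → Agree ω (M₀ + L) x y
  same-future {x} {x′} {y} {y′} Ex Ey e with first-mismatch (M₀ + L) x y
  ... | inj₂ A = A
  ... | inj₁ (m , m< , E) with m≤n⇒∃[o]m+o≡n (≰⇒> λ m≤M₀ → Exact⇒¬Agree (s≤s m≤M₀) E
                              (Agree-snoc (right-special-unique-ω (m≤m+n L _) Ex Ey) e))
  ...   | l , refl = ⊥-elim (not-agree {L} {suc l} {x} z<s (+-cancelˡ-< M₀ l L (<-trans (n<1+n _) m<))
            (Agree-≤ (m≤n+m (modulus L) L) (right-special-unique-ω (m≤m+n L _) Ex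
              (Exact-shift (suc l) (subst (λ m → Exact ω m x y) (cong suc (+-comm M₀ l)) E)))))

  opaque
    reference : ∃₂ λ q₀ q₁ → Fork M₀ q₀ q₁
    reference with right-special-exists-ω M₀
    ... | p , q , E with Exact⇒Fork E
    ...   | inj₁ F = p , q , F
    ...   | inj₂ F = q , p , F

  q₀ q₁ : ℕ
  q₀ = proj₁ reference
  q₁ = proj₁ (proj₂ reference)

  reference-fork : Fork M₀ q₀ q₁
  reference-fork = proj₂ (proj₂ reference)

  -- By `same-future` the last `M₀` letters before a fork, and what follows on either side up to
  -- depth `L`, are those of the reference fork. Comparisons of depth `L` near any fork can thus be
  -- made there.
  near-fork : ∀ {M p q m r} → Fork M p q → M₀ ≤ M → r ≤ L → m + r ≡ M →
    Agree ω L (p + m) (q₀ + (M₀ ∸ r)) × Agree ω L (q + m) (q₁ + (M₀ ∸ r))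
  near-fork {M} {p} {q} {m} {r} F M₀≤M r≤L m+r≡M
    with F′ ← subst (λ M → Fork M p q) (sym (m∸n+n≡m M₀≤M)) F
    = close p (same-future (Exact-shift d (prong F′)) (prong reference-fork)
        (trans (cong ω (+-assoc p d M₀)) (trans (to-zero F′) (sym (to-zero reference-fork))))) ,
      close q (same-future (Exact-shift d (Exact-sym (prong F′))) (Exact-sym (prong reference-fork))
        (trans (cong ω (+-assoc q d M₀)) (trans (to-one F′) (sym (to-one reference-fork)))))
    where
    d g : ℕ
    d = M ∸ M₀
    g = M₀ ∸ r
    d+M₀≡M : d + M₀ ≡ M
    d+M₀≡M = m∸n+n≡m M₀≤M
    g+r≡M₀ : g + r ≡ M₀
    g+r≡M₀ = m∸n+n≡m (≤-trans r≤L (m≤m+n L _))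
    m≡ : d + g ≡ m
    m≡ = +-cancelʳ-≡ r _ _ (trans (+-assoc d g r) (trans (cong (d +_) g+r≡M₀) (trans d+M₀≡M (sym m+r≡M))))
    close : ∀ p {q} → Agree ω (M₀ + L) (p + d) q → Agree ω L (p + m) (q + g)
    close p {q} A = subst (λ x → Agree ω L x (q + g)) (trans (+-assoc p d g) (cong (p +_) m≡))
      (Agree-≤ (m≤n+m L r) (Agree-shift g (subst (λ n → Agree ω n (p + d) q) (trans (cong (_+ L) (sym g+r≡M₀)) (+-assoc g r L)) A)))

  record LtWithin (x y : ℕ) : Set where
    constructor within
    field
      order : Lt ω x y
      short : position order < L
  open LtWithin

  LtWithin? : ∀ x y → Dec (LtWithin x y)
  LtWithin? x y with first-mismatch L x y
  ... | inj₂ A = no λ W → Exact⇒¬Agree (short W) (Lt⇒Exact (order W)) A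
  ... | inj₁ (m , m<L , E) with Exact⇒Fork E
  ...   | inj₁ F = yes (within (lt (agreement E) (to-zero F) (to-one F)) m<L)
  ...   | inj₂ F = no λ W → Lt-asym (order W) (lt (Agree-sym (agreement E)) (to-zero F) (to-one F))

  LtWithin-transport : ∀ {x y x′ y′} → LtWithin x y → Agree ω L x x′ → Agree ω L y y′ → LtWithin x′ y′
  LtWithin-transport (within o m<L) A B = within (Lt-transport o m<L A B) m<L

  -- q₀ + (M₀ ∸ r) and q₁ + (M₀ ∸ r) lie r letters before the reference fork; r ≤ L ≤ M₀ below.
  Straddled : ℕ → ℕ → Set
  Straddled r y = LtWithin (q₀ + (M₀ ∸ r)) y × LtWithin y (q₁ + (M₀ ∸ r))

  W : ℕ
  W = proj₁ (recurrent-ω L)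

  recur : ∀ x p → ∃ λ k → k < W × Agree ω L x (p + k)
  recur = proj₂ (recurrent-ω L)

  -- Only the first `L` letters at `y` matter, and they recur before position `W`.
  Straddled? : ∀ r → Dec (∃ (Straddled r))
  Straddled? r with find< (λ y → LtWithin? (q₀ + (M₀ ∸ r)) y ×-dec LtWithin? y (q₁ + (M₀ ∸ r))) W
  ... | inj₁ (y , _ , G) = yes (y , G)
  ... | inj₂ none = no λ (y , G₀ , G₁) → let k , k<W , A = recur y 0 in
          none k k<W (LtWithin-transport G₀ Agree-refl A , LtWithin-transport G₁ A Agree-refl)

  -- Existence is recorded only just below `c`; that single distance suffices to detect forks.
  record Threshold (c : ℕ) : Set where
    field
      none-above : ∀ r → c ≤ r → r < L → ¬ ∃ (Straddled r)
      some-below : ∀ r → suc r ≡ c → r < L × ∃ (Straddled r)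

  threshold-from : ∀ n → n ≤ L → (∀ r → n ≤ r → r < L → ¬ ∃ (Straddled r)) → ∃ Threshold
  threshold-from zero n≤L none = 0 , record { none-above = none ; some-below = λ _ () }
  threshold-from (suc n) n≤L none with Straddled? n
  ... | yes G = suc n , record { none-above = none ; some-below = λ { r refl → n≤L , G } }
  ... | no ¬G = threshold-from n (<⇒≤ n≤L) none′
    where
    none′ : ∀ r → n ≤ r → r < L → ¬ ∃ (Straddled r)
    none′ r n≤r r<L with m≤n⇒m<n∨m≡n n≤r
    ... | inj₁ n<r  = none r n<r r<L
    ... | inj₂ refl = ¬G

  opaque
    threshold : ∃ Threshold
    threshold = threshold-from L ≤-refl λ r L≤r r<L → ⊥-elim (<⇒≱ r<L L≤r)

  c : ℕ
  c = proj₁ threshold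

  open Threshold (proj₂ threshold)

  module _ {M p q : ℕ} (F : Fork M p q) (M₀≤M : M₀ ≤ M) where

    private
      L≤M : L ≤ M
      L≤M = ≤-trans (m≤m+n L _) M₀≤M

    fork-common : ∀ {k r} → k + r ≤ M → Agree ω r (p + k) (q + k)
    fork-common {k} k+r≤M = Agree-shift k (Agree-≤ k+r≤M (agreement (prong F)))

    module _ {k m r : ℕ} (k<m : k < m) (m+r≡M : m + r ≡ M) where

      private
        m≤M : m ≤ M
        m≤M = ≤-trans (m≤m+n m r) (≤-reflexive m+r≡M)
        k+r<M : k + r < M
        k+r<M = <-≤-trans (+-monoˡ-< r k<m) (≤-reflexive m+r≡M)
        at-k : ω (p + k + r) ≡ ω (q + k + r)
        at-k = Agree-at (k + r) (agreement (prong F)) k+r<M (+-assoc p k r) (+-assoc q k r)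
        at-p : ω (p + m + r) ≡ false
        at-p = trans (cong ω (trans (+-assoc p m r) (cong (p +_) m+r≡M))) (to-zero F)
        at-q : ω (q + m + r) ≡ true
        at-q = trans (cong ω (trans (+-assoc q m r) (cong (q +_) m+r≡M))) (to-one F)
        pq-k : Agree ω r (p + k) (q + k)
        pq-k = fork-common (<⇒≤ k+r<M)
        pq-m : Agree ω r (p + m) (q + m)
        pq-m = fork-common (≤-reflexive m+r≡M)

      -- Lt (p + k) (p + m) forces the letter 0 at k + r, and Lt (q + m) (q + k) forces 1.
      no-conflict₁ : Lt ω (p + k) (p + m) → Lt ω (q + m) (q + k) → ⊥
      no-conflict₁ ord ord′ with <-cmp (position ord) r | <-cmp (position ord′) r
      ... | tri< e<r _ _  | _ = Lt-asym (Lt-transport ord e<r pq-k pq-m) ord′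
      ... | _ | tri< e′<r _ _ = Lt-asym ord (Lt-transport ord′ e′<r (Agree-sym pq-m) (Agree-sym pq-k))
      ... | tri≈ _ refl _ | _ = case trans (sym (high ord)) at-p of λ ()
      ... | _ | tri≈ _ refl _ = case trans (sym (low ord′)) at-q of λ ()
      ... | tri> _ _ r<e | tri> _ _ r<e′ = case trans (sym (trans (letter (common ord) r r<e) at-p))
              (trans at-k (trans (sym (letter (common ord′) r r<e′)) at-q)) of λ ()

      -- The fork is farther from `k` than from `m`, so `p + k` and `q + k` share the letter at
      -- depth `r` too. If it is 0, `p + k` lies below `q + m`; if it is 1, `q + k` lies above
      -- `p + m`. So one of the two copies lies between `p + m` and `q + m`.
      straddle : (ord : Lt ω (q + k) (q + m)) (ord′ : Lt ω (p + m) (p + k)) →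
        r ≤ position ord → r ≤ position ord′ → position ord < L → position ord′ < L → ∃ (Straddled r)
      straddle ord ord′ r≤e r≤e′ e<L e′<L with near-fork F M₀≤M (<⇒≤ (≤-<-trans r≤e e<L)) m+r≡M | ω (p + k + r) in f
      ... | Ap , Aq | false = p + k , LtWithin-transport (within ord′ e′<L) Ap Agree-refl ,
              LtWithin-transport (within (lt (Agree-trans pq-k (Agree-≤ r≤e (common ord))) f at-q) (≤-<-trans r≤e e<L)) Agree-refl Aq
      ... | Ap , Aq | true = q + k ,
              LtWithin-transport (within (lt (Agree-trans (Agree-≤ r≤e′ (common ord′)) pq-k) at-p (trans (sym at-k) f)) (≤-<-trans r≤e e<L)) Ap Agree-refl ,
              LtWithin-transport (within ord e<L) Agree-refl Aq

      -- Comparisons decided before depth `r` see common letters only; those deeper than `L` are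
      -- settled by `long-order-preserved`; the remaining ones would give a straddled suffix.
      no-conflict₂ : c ≤ r → Lt ω (q + k) (q + m) → Lt ω (p + m) (p + k) → ⊥
      no-conflict₂ c≤r ord ord′ with position ord <? r | position ord′ <? r | L ≤? position ord | L ≤? position ord′
      ... | yes e<r | _ | _ | _ = Lt-asym (Lt-transport ord e<r (Agree-sym pq-k) (Agree-sym pq-m)) ord′
      ... | _ | yes e′<r | _ | _ = Lt-asym ord (Lt-transport ord′ e′<r pq-m pq-k)
      ... | _ | _ | yes long | _ =
              long-order-preserved L≤M (Exact-sym (prong F)) k<m m≤M (inj₁ (Agree-≤ long (common ord))) ord ord′
      ... | _ | _ | _ | yes long =
              long-order-preserved L≤M (Exact-sym (prong F)) k<m m≤M (inj₂ (Agree-≤ long (Agree-sym (common ord′)))) ord ord′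
      ... | no r≤e | no r≤e′ | no e<L | no e′<L =
              none-above r c≤r (≤-<-trans (≮⇒≥ r≤e) (≰⇒> e<L))
                (straddle ord ord′ (≮⇒≥ r≤e) (≮⇒≥ r≤e′) (≰⇒> e<L) (≰⇒> e′<L))

    -- The straddled suffix recurs at some `k` in the first `W` positions, with its `L` letters
    -- still in the part common to `p` and `q`; there it separates the two versions of the suffix r
    -- letters before the fork.
    conflict : ∀ {n r} → suc r ≡ c → W ≤ n → W + L ≤ M → M ≤ n + r →
      ∃₂ λ k m → k ≤ n × m ≤ n × Lt ω (p + m) (p + k) × Lt ω (q + k) (q + m)
    conflict {n} {r} r≡ W≤n W+L≤M M≤n+r
      with r<L , y , G₀ , G₁ ← some-below r r≡
      with k , k<W , A ← recur y p
      with m+r≡M ← m∸n+n≡m (≤-trans (<⇒≤ r<L) L≤M)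
      with Ap , Aq ← near-fork F M₀≤M (<⇒≤ r<L) m+r≡M
      = k , M ∸ r , <⇒≤ (<-≤-trans k<W W≤n) , +-cancelʳ-≤ r _ _ (≤-trans (≤-reflexive m+r≡M) M≤n+r) ,
        order (LtWithin-transport G₀ (Agree-sym Ap) A) ,
        order (LtWithin-transport G₁ (Agree-trans A (fork-common (≤-trans (+-monoˡ-≤ L (<⇒≤ k<W)) W+L≤M))) (Agree-sym Aq))

  SameOrder : ℕ → ℕ → ℕ → Set
  SameOrder n p q = ∀ k m → k ≤ n → m ≤ n → Lt ω (p + k) (p + m) → Lt ω (q + k) (q + m)

  -- `M₀` allows `near-fork`, and `W + L` leaves room for the recurrence used in `conflict`.
  N : ℕ
  N = M₀ + (W + L)

  -- Every offset up to `n` lies at least `c` letters before the first mismatch, where no order can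
  -- be reversed.
  agree⇒same-order : ∀ {n p q} → N ≤ n → Agree ω (n + c) p q → SameOrder n p q
  agree⇒same-order {n} {p} {q} N≤n A k m k≤n m≤n ord with p ≟ q
  ... | yes refl = ord
  ... | no p≢q with mismatch p≢q
  ...   | M , E = decide (Exact⇒Fork E)
    where
    n+c≤M : n + c ≤ M
    n+c≤M = ≮⇒≥ λ M< → Exact⇒¬Agree M< E A
    M₀≤M : M₀ ≤ M
    M₀≤M = ≤-trans (≤-trans (m≤m+n M₀ _) N≤n) (≤-trans (m≤m+n n c) n+c≤M)
    rest : ∀ {m} → m ≤ n → ∃ λ r → m + r ≡ M × c ≤ r
    rest {m} m≤n = M ∸ m , m+[n∸m]≡n (≤-trans m≤n (≤-trans (m≤m+n n c) n+c≤M)) ,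
      ≤-trans (≤-trans (≤-reflexive (sym (m+n∸m≡n m c))) (∸-monoˡ-≤ m (+-monoˡ-≤ c m≤n))) (∸-monoˡ-≤ m n+c≤M)
    decide : Fork M p q ⊎ Fork M q p → Lt ω (q + k) (q + m)
    decide F with <-cmp k m
    decide F | tri≈ _ refl _ = ⊥-elim (Lt-asym ord ord)
    decide F | tri< k<m k≢m _ with Lt-total {q + k} {q + m} (k≢m ∘ +-cancelˡ-≡ q k m) | rest m≤n | F
    ... | inj₁ ord′ | _ | _ = ord′
    ... | inj₂ ord′ | r , e , c≤r | inj₁ F′ = ⊥-elim (no-conflict₁ F′ M₀≤M k<m e ord ord′)
    ... | inj₂ ord′ | r , e , c≤r | inj₂ F′ = ⊥-elim (no-conflict₂ F′ M₀≤M k<m e c≤r ord ord′)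
    decide F | tri> _ k≢m m<k with Lt-total {q + k} {q + m} (k≢m ∘ +-cancelˡ-≡ q k m) | rest k≤n | F
    ... | inj₁ ord′ | _ | _ = ord′
    ... | inj₂ ord′ | r , e , c≤r | inj₁ F′ = ⊥-elim (no-conflict₂ F′ M₀≤M m<k e c≤r ord′ ord)
    ... | inj₂ ord′ | r , e , c≤r | inj₂ F′ = ⊥-elim (no-conflict₁ F′ M₀≤M m<k e ord′ ord)

  -- Comparing a suffix with the next one reveals its first letter.
  same-order⇒letters : ∀ {n p q} → SameOrder n p q → Agree ω n p q
  same-order⇒letters {n} {p} {q} O = agree same
    where
    same : ∀ k → k < n → ω (p + k) ≡ ω (q + k)
    same k k<n with ω (p + k) in ep | ω (q + k) in eq
    ... | false | false = refl
    ... | true  | true  = refl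
    ... | false | true with Lt-total {p + k} {suc (p + k)} (<⇒≢ (n<1+n _))
    ...   | inj₂ ord = ⊥-elim (¬Lt-next ep ord)
    ...   | inj₁ ord = ⊥-elim (¬Lt-next′ eq (subst (Lt ω (q + k)) (+-suc q k)
              (O k (suc k) (<⇒≤ k<n) k<n (subst (Lt ω (p + k)) (sym (+-suc p k)) ord))))
    same k k<n | true | false with Lt-total {p + k} {suc (p + k)} (<⇒≢ (n<1+n _))
    ...   | inj₁ ord = ⊥-elim (¬Lt-next′ ep ord)
    ...   | inj₂ ord = ⊥-elim (¬Lt-next eq (subst (λ x → Lt ω x (q + k)) (+-suc q k)
              (O (suc k) k k<n (<⇒≤ k<n) (subst (λ x → Lt ω x (p + k)) (sym (+-suc p k)) ord))))

  -- A mismatch before `n` is excluded by the letters. For one at M with n ≤ M < n + c, the offset M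
  -- - (c - 1) is at most n, and `conflict` finds a pair in different order.
  same-order⇒agree : ∀ {n p q} → N ≤ n → SameOrder n p q → Agree ω (n + c) p q
  same-order⇒agree {n} {p} {q} N≤n O with first-mismatch (n + c) p q
  ... | inj₂ A = A
  ... | inj₁ (M , M<n+c , E) = ⊥-elim (go c refl (Exact⇒Fork E))
    where
    n≤M : n ≤ M
    n≤M = ≮⇒≥ λ M<n → Exact⇒¬Agree M<n E (same-order⇒letters O)
    N≤M : N ≤ M
    N≤M = ≤-trans N≤n n≤M
    W+L≤N : W + L ≤ N
    W+L≤N = m≤n+m (W + L) M₀
    W≤n : W ≤ n
    W≤n = ≤-trans (≤-trans (m≤m+n W L) W+L≤N) N≤n
    go : ∀ c′ → c′ ≡ c → Fork M p q ⊎ Fork M q p → ⊥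
    go zero e _ = <⇒≱ M<n+c (≤-trans (≤-reflexive (trans (cong (n +_) (sym e)) (+-identityʳ n))) n≤M)
    go (suc r) e F with M≤n+r ← s≤s⁻¹ (≤-trans M<n+c (≤-reflexive (trans (cong (n +_) (sym e)) (+-suc n r)))) | F
    ... | inj₁ F′ = let k , m , k≤n , m≤n , ord , ord′ = conflict F′ (≤-trans (m≤m+n M₀ _) N≤M) e W≤n (≤-trans W+L≤N N≤M) M≤n+r
                    in Lt-asym (O m k m≤n k≤n ord) ord′
    ... | inj₂ F′ = let k , m , k≤n , m≤n , ord , ord′ = conflict F′ (≤-trans (m≤m+n M₀ _) N≤M) e W≤n (≤-trans W+L≤N N≤M) M≤n+r
                    in Lt-asym (O k m k≤n m≤n ord′) ord

-- Permutations and counting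

injective⇒surjective : ∀ {n} {f : Fin n → Fin n} → Injective _≡_ _≡_ f → ∀ y → ∃ λ x → f x ≡ y
injective⇒surjective {suc n} {f} f-inj y with Fin.any? (λ x → f x Fin.≟ y)
... | yes hit = hit
... | no miss =
  let i , j , i<j , e = Fin.pigeonhole ≤-refl (λ x → punchOut (avoids x))
  in ⊥-elim (Fin.<⇒≢ i<j (f-inj (Fin.punchOut-injective (avoids i) (avoids j) e)))
  where
  avoids : ∀ x → y ≢ f x
  avoids x e = miss (x , sym e)

-- Strong induction on the value `g k`: whichever of `f k` and `g k` is smaller is also attained by
-- the other permutation, at some `m` to which the induction applies.
order-determines : ∀ {n} {f g : Fin n → Fin n} → Injective _≡_ _≡_ f → Injective _≡_ _≡_ g →
  (∀ k m → f k <ᶠ f m → g k <ᶠ g m) → ∀ k → f k ≡ g k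
order-determines {n} {f} {g} f-inj g-inj f⇒g k = below (suc (toℕ (g k))) k ≤-refl
  where
  below : ∀ v k → toℕ (g k) < v → f k ≡ g k
  below (suc v) k g<v with Fin.<-cmp (f k) (g k)
  ... | tri≈ _ e _ = e
  ... | tri< f<g _ _ with m , gm≡ ← injective⇒surjective g-inj (f k) =
          ⊥-elim (Fin.<⇒≢ f<g (trans (sym gm≡) (cong g (f-inj (trans (below v m
            (<-≤-trans (subst (λ x → x <ᶠ g k) (sym gm≡) f<g) (s≤s⁻¹ g<v))) gm≡)))))
  ... | tri> _ _ g<f with m , fm≡ ← injective⇒surjective f-inj (g k) =
          let gm<gk = f⇒g m k (subst (_<ᶠ f k) (sym fm≡) g<f)
          in ⊥-elim (Fin.<⇒≢ gm<gk (trans (sym (below v m (<-≤-trans gm<gk (s≤s⁻¹ g<v)))) fm≡))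

# : ∀ {n} → (Fin n → Bool) → ℕ
# {zero}  f = 0
# {suc n} f = bit (f fzero) + # (f ∘ fsuc)

bit-mono : ∀ {b c} → (b ≡ true → c ≡ true) → bit b ≤ bit c
bit-mono {false} h = z≤n
bit-mono {true}  h rewrite h refl = ≤-refl

#-mono : ∀ {n} {f g : Fin n → Bool} → (∀ k → f k ≡ true → g k ≡ true) → # f ≤ # g
#-mono {zero}  h = z≤n
#-mono {suc n} h = +-mono-≤ (bit-mono (h fzero)) (#-mono (h ∘ fsuc))

#-strict : ∀ {n} {f g : Fin n → Bool} → (∀ k → f k ≡ true → g k ≡ true) → ∀ k → f k ≡ false → g k ≡ true → # f < # g
#-strict {suc n} h fzero    fk gk rewrite fk | gk = s≤s (#-mono (h ∘ fsuc))
#-strict {suc n} h (fsuc k) fk gk = +-mono-≤-< (bit-mono (h fzero)) (#-strict (h ∘ fsuc) k fk gk)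

#-true : ∀ n → # {n} (λ _ → true) ≡ n
#-true zero    = refl
#-true (suc n) = cong suc (#-true n)

module Ranking {n : ℕ} {_≺_ : Fin n → Fin n → Set} (_≺?_ : ∀ k m → Dec (k ≺ m))
  (≺-trans : ∀ {k l m} → k ≺ l → l ≺ m → k ≺ m) (≺-asym : ∀ {k m} → k ≺ m → ¬ m ≺ k)
  (≺-total : ∀ {k m} → k ≢ m → k ≺ m ⊎ m ≺ k) where

  before : Fin n → Fin n → Bool
  before k m = does (m ≺? k)

  before-true : ∀ {k m} → m ≺ k → before k m ≡ true
  before-true {k} {m} = dec-true (m ≺? k)

  before-false : ∀ {k m} → ¬ m ≺ k → before k m ≡ false
  before-false {k} {m} = dec-false (m ≺? k)

  true-before : ∀ {k m} → before k m ≡ true → m ≺ k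
  true-before {k} {m} e with m ≺? k
  ... | yes m≺k = m≺k

  rank< : ∀ k → # (before k) < n
  rank< k = <-≤-trans (#-strict {g = λ _ → true} (λ _ _ → refl) k (before-false λ k≺k → ≺-asym k≺k k≺k) refl) (≤-reflexive (#-true n))

  rank : Fin n → Fin n
  rank k = fromℕ< (rank< k)

  rank-mono : ∀ {k m} → k ≺ m → rank k <ᶠ rank m
  rank-mono {k} {m} k≺m = subst₂ _<_ (sym (Fin.toℕ-fromℕ< (rank< k))) (sym (Fin.toℕ-fromℕ< (rank< m)))
    (#-strict (λ l l≺k → before-true (≺-trans (true-before l≺k) k≺m)) k (before-false λ k≺k → ≺-asym k≺k k≺k) (before-true k≺m))

  rank-injective : Injective _≡_ _≡_ rank
  rank-injective {k} {m} e with k Fin.≟ m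
  ... | yes k≡m = k≡m
  ... | no k≢m with ≺-total k≢m
  ...   | inj₁ k≺m = ⊥-elim (Fin.<⇒≢ (rank-mono k≺m) e)
  ...   | inj₂ m≺k = ⊥-elim (Fin.<⇒≢ (rank-mono m≺k) (sym e))

  rank-reflects : ∀ {k m} → rank k <ᶠ rank m → k ≺ m
  rank-reflects {k} {m} r< with k Fin.≟ m
  ... | yes refl = ⊥-elim (<-irrefl refl r<)
  ... | no k≢m with ≺-total k≢m
  ...   | inj₁ k≺m = k≺m
  ...   | inj₂ m≺k = ⊥-elim (<-asym r< (rank-mono m≺k))

-- Positions below `W` meet every class, so a transversal is collected from them, keeping each
-- position not related to one already kept.
finite-classes : ∀ {R : ℕ → ℕ → Set} → (∀ {x} → R x x) → (∀ {x y} → R x y → R y x) → (∀ {x y z} → R x y → R y z → R x z) →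
  (∀ x y → Dec (R x y)) → ∀ W → (∀ x → ∃ λ k → k < W × R x k) → ∃ (Classes R)
finite-classes {R} R-refl R-sym R-trans R? W cover =
  let c , rep , rep-inj , hit = partial W in
  c , record
    { rep      = rep
    ; rep-inj  = rep-inj _ _
    ; class    = λ x → proj₁ (hit _ (proj₁ (proj₂ (cover x))))
    ; classify = λ x → R-trans (proj₂ (proj₂ (cover x))) (proj₂ (hit _ (proj₁ (proj₂ (cover x)))))
    }
  where
  partial : ∀ n → ∃ λ c → ∃ λ (rep : Fin c → ℕ) →
    (∀ k l → R (rep k) (rep l) → k ≡ l) × (∀ x → x < n → ∃ λ k → R x (rep k))
  partial zero = 0 , (λ ()) , (λ ()) , λ _ ()
  partial (suc n) with partial n
  ... | c , rep , rep-inj , hit with Fin.any? (λ k → R? n (rep k))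
  ...   | yes (k , n~k) = c , rep , rep-inj , hit′
    where
    hit′ : ∀ x → x < suc n → ∃ λ k → R x (rep k)
    hit′ x x<1+n with m≤n⇒m<n∨m≡n (s≤s⁻¹ x<1+n)
    ... | inj₁ x<n  = hit x x<n
    ... | inj₂ refl = k , n~k
  ...   | no new = suc c , rep′ , inj′ , hit′
    where
    rep′ : Fin (suc c) → ℕ
    rep′ fzero    = n
    rep′ (fsuc k) = rep k
    inj′ : ∀ k l → R (rep′ k) (rep′ l) → k ≡ l
    inj′ fzero    fzero    _ = refl
    inj′ fzero    (fsuc l) r = ⊥-elim (new (l , r))
    inj′ (fsuc k) fzero    r = ⊥-elim (new (k , R-sym r))
    inj′ (fsuc k) (fsuc l) r = cong fsuc (rep-inj k l r)
    hit′ : ∀ x → x < suc n → ∃ λ k → R x (rep′ k)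
    hit′ x x<1+n with m≤n⇒m<n∨m≡n (s≤s⁻¹ x<1+n)
    ... | inj₁ x<n  = let k , r = hit x x<n in fsuc k , r
    ... | inj₂ refl = fzero , R-refl

Lt⇒SufLt : ∀ {ω i j} → Lt ω i j → SufLt ω i j
Lt⇒SufLt (lt {m} A lo hi) = m , letter A , lo , hi

SufLt⇒Lt : ∀ {ω i j} → SufLt ω i j → Lt ω i j
SufLt⇒Lt (m , A , lo , hi) = lt (agree A) lo hi

module Counting {s ω : Word} (sturmian : Sturmian s) (I : MarkedImage s ω) where

  open Branching sturmian I
  open Comparison sturmian I

  -- Each old representative keeps one extension; the only extension missed is the other
  -- continuation `z` of the unique right special factor.
  factor-extension : ∀ {M c} → L ≤ M → Classes (Agree ω M) c → Classes (Agree ω (suc M)) (suc c)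
  factor-extension {M} {c} L≤M C with right-special-exists-ω M
  ... | p , q , E with Exact-avoid E (Classes.rep C (Classes.class C p))
  ...   | z , p~z , z≁ = record { rep = rep′ ; rep-inj = λ {k} {l} → inj′ k l ; class = proj₁ ∘ find ; classify = proj₂ ∘ find }
    where
    open Classes C
    rep′ : Fin (suc c) → ℕ
    rep′ fzero    = z
    rep′ (fsuc k) = rep k
    not-rep : ∀ k → ¬ Agree ω (suc M) z (rep k)
    not-rep k A with refl ← rep-inj (Agree-trans (Agree-sym (classify p)) (Agree-trans p~z (Agree-≤ (n≤1+n M) A))) = z≁ A
    inj′ : ∀ k l → Agree ω (suc M) (rep′ k) (rep′ l) → k ≡ l
    inj′ fzero    fzero    _ = refl
    inj′ fzero    (fsuc l) A = ⊥-elim (not-rep l A)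
    inj′ (fsuc k) fzero    A = ⊥-elim (not-rep k (Agree-sym A))
    inj′ (fsuc k) (fsuc l) A = cong fsuc (rep-inj (Agree-≤ (n≤1+n M) A))
    find : ∀ x → ∃ λ k → Agree ω (suc M) x (rep′ k)
    find x with Agree? (suc M) x (rep (class x))
    ... | yes A = fsuc (class x) , A
    ... | no ¬A = fzero , Agree-snoc (Agree-trans x~p p~z) (≢-forces-≡ x≢ z≢)
      where
      x~p : Agree ω M x p
      x~p = right-special-unique-ω L≤M (Agree-¬snoc (classify x) ¬A) E
      same-class : class x ≡ class p
      same-class = rep-inj (Agree-trans (Agree-sym (classify x)) (Agree-trans x~p (classify p)))
      x≢ : ω (x + M) ≢ ω (rep (class p) + M)
      x≢ e = ¬A (subst (λ k → Agree ω (suc M) x (rep k)) (sym same-class) (Agree-snoc (Agree-trans x~p (classify p)) e))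
      z≢ : ω (z + M) ≢ ω (rep (class p) + M)
      z≢ e = z≁ (Agree-snoc (Agree-trans (Agree-sym p~z) (classify p)) e)

  base : ∃ (Classes (Agree ω L))
  base = finite-classes Agree-refl Agree-sym Agree-trans (Agree? L) W λ x → recur x 0

  factor-count : ∀ j → Classes (Agree ω (j + L)) (j + proj₁ base)
  factor-count zero    = proj₂ base
  factor-count (suc j) = factor-extension (m≤n+m L j) (factor-count j)

  Lt? : ∀ x y → Dec (Lt ω x y)
  Lt? x y with x ≟ y
  ... | yes refl = no λ l → Lt-asym l l
  ... | no x≢y with Lt-total x≢y
  ...   | inj₁ x<y = yes x<y
  ...   | inj₂ y<x = no λ x<y → Lt-asym x<y y<x

  module Perm (n p : ℕ) where
    open Ranking {n} {λ k m → Lt ω (p + toℕ k) (p + toℕ m)} (λ k m → Lt? _ _) Lt-trans Lt-asym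
      (λ k≢m → Lt-total λ e → k≢m (Fin.toℕ-injective (+-cancelˡ-≡ p _ _ e))) public

  opaque
    perm : ∀ n → ℕ → Vec (Fin n) n
    perm n p = tabulate (Perm.rank n p)

    perm-rank : ∀ n p k → lookup (perm n p) k ≡ Perm.rank n p k
    perm-rank n p = Vec.lookup∘tabulate (Perm.rank n p)

  perm-< : ∀ n p k m → (lookup (perm n p) k <ᶠ lookup (perm n p) m) ⇔ SufLt ω (p + toℕ k) (p + toℕ m)
  perm-< n p k m = mk⇔
    (λ l → Lt⇒SufLt (Perm.rank-reflects n p (subst₂ _<ᶠ_ (perm-rank n p k) (perm-rank n p m) l)))
    (λ l → subst₂ _<ᶠ_ (sym (perm-rank n p k)) (sym (perm-rank n p m)) (Perm.rank-mono n p (SufLt⇒Lt l)))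

  perm-subperm : ∀ n p → Subperm ω n (perm n p)
  perm-subperm n p = (λ e → Perm.rank-injective n p (trans (sym (perm-rank n p _)) (trans e (perm-rank n p _)))) , p , perm-< n p

  subperm-unique : ∀ {n σ τ} → Subperm ω n σ → Subperm ω n τ →
    (∀ k m → lookup σ k <ᶠ lookup σ m → lookup τ k <ᶠ lookup τ m) → σ ≡ τ
  subperm-unique {σ = σ} {τ} (σ-inj , _) (τ-inj , _) h = lookup-ext σ τ (order-determines σ-inj τ-inj h)

  subperm-perm : ∀ {n σ} (P : Subperm ω n σ) → σ ≡ perm n (proj₁ (proj₂ P))
  subperm-perm {n} P@(_ , i , order) = subperm-unique P (perm-subperm n i)
    λ k m → Equivalence.from (perm-< n i k m) ∘ Equivalence.to (order k m)

  perm-agree : ∀ {n p q} → N ≤ n → perm (suc n) p ≡ perm (suc n) q → Agree ω (n + c) p q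
  perm-agree {n} {p} {q} N≤n e = same-order⇒agree N≤n λ k m k≤n m≤n ord →
    subst₂ (λ k m → Lt ω (q + k) (q + m)) (Fin.toℕ-fromℕ< (s≤s k≤n)) (Fin.toℕ-fromℕ< (s≤s m≤n))
      (SufLt⇒Lt (Equivalence.to (perm-< (suc n) q (fromℕ< (s≤s k≤n)) (fromℕ< (s≤s m≤n)))
        (subst (λ σ → lookup σ (fromℕ< (s≤s k≤n)) <ᶠ lookup σ (fromℕ< (s≤s m≤n))) e
          (Equivalence.from (perm-< (suc n) p (fromℕ< (s≤s k≤n)) (fromℕ< (s≤s m≤n)))
            (Lt⇒SufLt (subst₂ (λ k m → Lt ω (p + k) (p + m)) (sym (Fin.toℕ-fromℕ< (s≤s k≤n))) (sym (Fin.toℕ-fromℕ< (s≤s m≤n))) ord))))))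

  agree-perm : ∀ {n p q} → N ≤ n → Agree ω (n + c) p q → perm (suc n) p ≡ perm (suc n) q
  agree-perm {n} {p} {q} N≤n A = subperm-unique (perm-subperm (suc n) p) (perm-subperm (suc n) q) λ k m l →
    Equivalence.from (perm-< (suc n) q k m) (Lt⇒SufLt
      (agree⇒same-order N≤n A (toℕ k) (toℕ m) (s≤s⁻¹ (Fin.toℕ<n k)) (s≤s⁻¹ (Fin.toℕ<n m))
        (SufLt⇒Lt (Equivalence.to (perm-< (suc n) p k m) l))))

  subperm-count : ∀ {n d} → N ≤ n → Classes (Agree ω (n + c)) d → HasCard (Subperm ω (suc n)) d
  subperm-count {n} {d} N≤n C = List.tabulate (perm (suc n) ∘ rep) ,
    tabulate⁺ (λ e → rep-inj (perm-agree N≤n e)) ,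
    length-tabulate (perm (suc n) ∘ rep) ,
    λ σ → mk⇔
      (λ P → subst (_∈ _) (sym (trans (subperm-perm P) (agree-perm N≤n (classify _)))) (∈-tabulate⁺ (class _)))
      (λ σ∈ → let k , e = ∈-tabulate⁻ σ∈ in subst (Subperm ω (suc n)) (sym e) (perm-subperm (suc n) (rep k)))
    where open Classes C

-- The word T(s) as a marked image

nth-++ˡ : ∀ xs {ys i} → i < length xs → nth (xs ++ ys) i ≡ nth xs i
nth-++ˡ (x ∷ xs) {i = zero}  _         = refl
nth-++ˡ (x ∷ xs) {i = suc i} (s≤s i<n) = nth-++ˡ xs i<n

nth-++ʳ : ∀ xs {ys} o → nth (xs ++ ys) (length xs + o) ≡ nth ys o
nth-++ʳ []       o = refl
nth-++ʳ (x ∷ xs) o = nth-++ʳ xs o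

nth-last : ∀ x xs → nth (x ∷ xs) (length xs) ≡ last (x List⁺.∷ xs)
nth-last x xs with List.initLast xs
nth-last x .[]             | List.[]       = refl
nth-last x .(ys List.∷ʳ y) | ys List.∷ʳ′ y =
  trans (cong (nth (x ∷ ys List.∷ʳ y)) (trans (length-++ ys) (+-suc (length ys) 0))) (nth-++ʳ (x ∷ ys) 0)

module Morphism (s : Word) (a b : List⁺ Bool) (marked : Marked a b) where

  T : Bool → List⁺ Bool
  T = img a b

  size : Bool → ℕ
  size c = length (toList (T c))

  position-of : ℕ → ℕ
  position-of i = length (prefixImage a b s i)

  position-suc : ∀ i → position-of (suc i) ≡ position-of i + size (s i)
  position-suc i = length-++ (prefixImage a b s i)

  -- `applyMorph` reads letter i from the image of i + 1 letters; by stability it can be read from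
  -- the prefix that ends with its block instead.
  prefix-stable : ∀ m k {p} → p < position-of m → nth (prefixImage a b s (m + k)) p ≡ nth (prefixImage a b s m) p
  prefix-stable m zero    p< = cong (λ m → nth (prefixImage a b s m) _) (+-identityʳ m)
  prefix-stable m (suc k) {p} p< = begin
    nth (prefixImage a b s (m + suc k)) p     ≡⟨ cong (λ m → nth (prefixImage a b s m) p) (+-suc m k) ⟩
    nth (prefixImage a b s (suc (m + k))) p   ≡⟨ nth-++ˡ (prefixImage a b s (m + k)) (<-≤-trans p< (grows k)) ⟩
    nth (prefixImage a b s (m + k)) p         ≡⟨ prefix-stable m k p< ⟩
    nth (prefixImage a b s m) p               ∎
    where
    open ≡-Reasoning
    grows : ∀ k → position-of m ≤ position-of (m + k)
    grows zero    = ≤-reflexive (cong position-of (sym (+-identityʳ m)))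
    grows (suc k) = ≤-trans (grows k) (≤-trans (m≤m+n _ (size (s (m + k))))
      (≤-reflexive (trans (sym (position-suc (m + k))) (cong position-of (sym (+-suc m k))))))

  n≤position : ∀ n → n ≤ position-of n
  n≤position zero    = z≤n
  n≤position (suc n) = ≤-trans (≤-reflexive (+-comm 1 n))
    (≤-trans (+-mono-≤ (n≤position n) (s≤s z≤n)) (≤-reflexive (sym (position-suc n))))

  image-letter : ∀ i o → o < size (s i) → applyMorph a b s (position-of i + o) ≡ nth (toList (T (s i))) o
  image-letter i o o< = trans same (nth-++ʳ (prefixImage a b s i) o)
    where
    p = position-of i + o
    p<i : p < position-of (suc i)
    p<i = <-≤-trans (+-monoʳ-< (position-of i) o<) (≤-reflexive (sym (position-suc i)))
    same : nth (prefixImage a b s (suc p)) p ≡ nth (prefixImage a b s (suc i)) p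
    same with ≤-total (suc i) (suc p)
    ... | inj₁ le with k , e ← m≤n⇒∃[o]m+o≡n le =
      trans (cong (λ m → nth (prefixImage a b s m) p) (sym e)) (prefix-stable (suc i) k p<i)
    ... | inj₂ ge with k , e ← m≤n⇒∃[o]m+o≡n ge =
      sym (trans (cong (λ m → nth (prefixImage a b s m) p) (sym e)) (prefix-stable (suc p) k (n≤position (suc p))))

  head-inj : ∀ {c d} → nth (toList (T c)) 0 ≡ nth (toList (T d)) 0 → c ≡ d
  head-inj {false} {false} _ = refl
  head-inj {true}  {true}  _ = refl
  head-inj {false} {true}  e = ⊥-elim (proj₁ marked e)
  head-inj {true}  {false} e = ⊥-elim (proj₁ marked (sym e))

  last-letter : ∀ c {m} → suc m ≡ size c → nth (toList (T c)) m ≡ last (T c)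
  last-letter c refl = nth-last (head (T c)) (tail (T c))

  last-inj : ∀ {c d m n} → suc m ≡ size c → suc n ≡ size d → nth (toList (T c)) m ≡ nth (toList (T d)) n → c ≡ d
  last-inj {c} {d} ec ed e = distinct (trans (sym (last-letter c ec)) (trans e (last-letter d ed)))
    where
    distinct : ∀ {c d} → last (T c) ≡ last (T d) → c ≡ d
    distinct {false} {false} _ = refl
    distinct {true}  {true}  _ = refl
    distinct {false} {true}  e = ⊥-elim (proj₂ marked e)
    distinct {true}  {false} e = ⊥-elim (proj₂ marked (sym e))

  marked-image : MarkedImage s (applyMorph a b s)
  marked-image = record
    { len = size ; image = λ c → nth (toList (T c)) ; len>0 = λ _ → z<s ; first-inj = head-inj ; last-inj = last-inj
    ; cut = position-of ; cut-zero = refl ; cut-suc = position-suc ; letter-at = image-letter }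

open import Data.Integer using (+_)

difference : ∀ {x y u v} → x + y ≡ u + v → + x ≡ + u ℤ.+ (+ v ℤ.- + y)
difference {x} {y} {u} {v} e = begin
  + x                           ≡⟨ ℤ.+-identityʳ (+ x) ⟨
  + x ℤ.+ + 0                   ≡⟨ cong (λ z → + x ℤ.+ z) (ℤ.+-inverseʳ (+ y)) ⟨
  + x ℤ.+ (+ y ℤ.- + y)         ≡⟨ ℤ.+-assoc (+ x) (+ y) (ℤ.- + y) ⟨
  + (x + y) ℤ.- + y             ≡⟨ cong (λ z → + z ℤ.- + y) e ⟩
  + (u + v) ℤ.- + y             ≡⟨ ℤ.+-assoc (+ u) (+ v) (ℤ.- + y) ⟩
  + u ℤ.+ (+ v ℤ.- + y)         ∎
  where open ≡-Reasoning

theorem6 : (s : Word) → Sturmian s → (a b : List⁺ Bool) → Marked a b →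
    Σ ℕ λ N → Σ ℤ λ k → ∀ (n : ℕ) → N < n → PermComplexityIs (applyMorph a b s) n (+ n ℤ.+ k)
-- With b factors of length `L` there are n + c - L + b factors of length n + c, hence as many
-- subpermutations of length n + 1; subtracting n + 1 leaves the constant.
theorem6 s sturmian a b marked = N , + (c + proj₁ base) ℤ.- + suc L , count
  where
  marked-image : MarkedImage s (applyMorph a b s)
  marked-image = Morphism.marked-image s a b marked
  open Counting sturmian marked-image
  open Comparison sturmian marked-image using (N; c; M₀)
  open Branching sturmian marked-image using (L)
  count : ∀ n → N < n → PermComplexityIs (applyMorph a b s) n (+ n ℤ.+ (+ (c + proj₁ base) ℤ.- + suc L))
  count (suc n) (s≤s N≤n) with m≤n⇒∃[o]m+o≡n (≤-trans (≤-trans (m≤m+n L _) (≤-trans (m≤m+n M₀ _) N≤n)) (m≤m+n n c))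
  ... | j , L+j≡ = j + proj₁ base ,
    subperm-count N≤n (subst (λ M → Classes (Agree (applyMorph a b s) M) (j + proj₁ base)) (trans (+-comm j L) L+j≡) (factor-count j)) ,
    difference {j + proj₁ base} {suc L} {suc n} {c + proj₁ base} (arith L c (proj₁ base) L+j≡)
    where
    arith : ∀ l c b → l + j ≡ n + c → j + b + suc l ≡ suc n + (c + b)
    arith l c b e = lin≡ e (solve (l ∷ c ∷ b ∷ j ∷ n ∷ []))
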